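{- Let $t\ge 2$ be an integer and let $\beta>1$ be a root of $x^{3}-2tx^{2}+2tx-t$. Then $\beta$ has property (F$_1$) but does not have property (PF).
   Context: For a real number $\beta>1$, let $T:[0,1]\to[0,1)$, $T(x)=\beta x-\lfloor \beta x\rfloor$. For $x\in[0,1]$ put $d_\beta(x)=c_1c_2\cdots$ with $c_n=\lfloor \beta T^{n-1}(x)\rfloor$, so that $x=\sum_{n\ge1}c_n\beta^{ -n}$. For $x\ge 0$ let $L(x)=\min\{n\in\mathbb{N}_0: x\beta^{ -n}<1\}$. A number $x\ge0$ has a finite beta-expansion if $d_\beta(\beta^{ -L(x)}x)$ has only finitely many nonzero digits; $\mathrm{Fin}(\beta)$ denotes the set of such $x\ge 0$. Property (F$_1$): $\mathbb{N}_0\subset \mathrm{Fin}(\beta)$. Property (PF): $\mathbb{N}_0[1/\beta]\subset\mathrm{Fin}(\beta)$, where $\mathbb{N}_0[1/\beta]$ is the set of polynomial expressions in $1/\beta$ with nonnegative integer coefficients. -}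

module Defs where

open import Level using (Level; _⊔_) renaming (suc to lsuc)
open import Data.Nat as ℕ using (ℕ; zero; suc)
open import Data.Integer as ℤ using (ℤ; +_; -[1+_])
open import Data.List using (List; []; _∷_)
open import Data.Product using (Σ; _×_; ∃)
open import Relation.Nullary using (¬_)
open import Relation.Binary.PropositionalEquality using (_≡_)
open import Relation.Binary.Core using (Rel)
open import Relation.Binary.Structures using (IsStrictTotalOrder)
open import Algebra.Bundles using (CommutativeRing)
import Data.Sum

module RingOps {c ℓ} (R : CommutativeRing c ℓ) where
  open CommutativeRing R

  infixl 6 _-ᴿ_
  _-ᴿ_ : Carrier → Carrier → Carrier
  x -ᴿ y = x + (- y)

  fromℕ : ℕ → Carrier
  fromℕ zero    = 0#
  fromℕ (suc n) = 1# + fromℕ n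

  fromℤ : ℤ → Carrier
  fromℤ (+ n)      = fromℕ n
  fromℤ -[1+ n ]   = - fromℕ (suc n)

  infixr 8 _^ᴿ_
  _^ᴿ_ : Carrier → ℕ → Carrier
  x ^ᴿ zero  = 1#
  x ^ᴿ suc n = x * (x ^ᴿ n)

-- An ordered field (commutative ring, strict total order compatible with
-- + and *, inverses of nonzero elements) equipped with a floor function
-- (hence Archimedean).  The real numbers ℝ are such a structure; since every
-- Archimedean ordered field embeds order-preservingly into ℝ (and floors are
-- determined by the order), beta-expansion statements about a root β lying in
-- such a field are the same as for the corresponding real β.
record FloorField c ℓ r : Set (lsuc (c ⊔ ℓ ⊔ r)) where
  field
    cring : CommutativeRing c ℓ
  open CommutativeRing cring
  open RingOps cring
  field
    _<_            : Rel Carrier r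
    isStrictTotalOrder : IsStrictTotalOrder _≈_ _<_
    0<1            : 0# < 1#
    +-mono-<       : ∀ {x y} z → x < y → (x + z) < (y + z)
    *-pos          : ∀ {x y} → 0# < x → 0# < y → 0# < (x * y)
    inv            : Carrier → Carrier
    inv-correct    : ∀ x → ¬ (x ≈ 0#) → (x * inv x) ≈ 1#
    ⌊_⌋            : Carrier → ℤ
    floor-≤        : ∀ x → (fromℤ ⌊ x ⌋ < x) Data.Sum.⊎ (fromℤ ⌊ x ⌋ ≈ x)
    floor-<        : ∀ x → x < (fromℤ ⌊ x ⌋ + 1#)

module Beta {c ℓ r} (F : FloorField c ℓ r) where
  open FloorField F
  open CommutativeRing cring
  open RingOps cring public

  _≤_ : Carrier → Carrier → Set _
  x ≤ y = (x < y) Data.Sum.⊎ (x ≈ y)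

  module _ (β : Carrier) where
    T : Carrier → Carrier
    T x = (β * x) -ᴿ fromℤ ⌊ β * x ⌋

    Tⁿ : ℕ → Carrier → Carrier
    Tⁿ zero    x = x
    Tⁿ (suc n) x = T (Tⁿ n x)

    -- digit k x = c_{k+1} = ⌊ β T^k(x) ⌋   (digits indexed from 1 in the paper)
    digit : ℕ → Carrier → ℤ
    digit k x = ⌊ β * Tⁿ k x ⌋

    FiniteDigits : Carrier → Set
    FiniteDigits x = Σ ℕ λ N → ∀ k → N ℕ.≤ k → digit k x ≡ + 0

    β⁻¹ : Carrier
    β⁻¹ = inv β

    IsL : Carrier → ℕ → Set r
    IsL x n = ((x * (β⁻¹ ^ᴿ n)) < 1#) × (∀ m → m ℕ.< n → ¬ ((x * (β⁻¹ ^ᴿ m)) < 1#))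

    InFin : Carrier → Set (ℓ ⊔ r)
    InFin x = (0# ≤ x) × Σ ℕ λ n → IsL x n × FiniteDigits (x * (β⁻¹ ^ᴿ n))

    evalInv : List ℕ → Carrier
    evalInv []       = 0#
    evalInv (a ∷ as) = fromℕ a + (β⁻¹ * evalInv as)

    PropF1 : Set (ℓ ⊔ r)
    PropF1 = ∀ (n : ℕ) → InFin (fromℕ n)

    PropPF : Set (ℓ ⊔ r)
    PropPF = ∀ (as : List ℕ) → InFin (evalInv as)

    GreaterThanOne : Set r
    GreaterThanOne = 1# < β

    IsRootOfCubic : ℕ → Set ℓ
    IsRootOfCubic t =
      ((((β ^ᴿ 3) -ᴿ (fromℕ (2 ℕ.* t) * (β ^ᴿ 2))) + (fromℕ (2 ℕ.* t) * β)) -ᴿ fromℕ t) ≈ 0#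

Car : ∀ {c ℓ r} → FloorField c ℓ r → Set c
Car F = CommutativeRing.Carrier (FloorField.cring F)

-- Put w = t/β and u = 2t − β, so that β w = t, β u = 2t − w and, eliminating β, w + 2uw = 2w² + u².
-- For x₀ = n β⁻ᴸ there is an integer sequence z, the carries, with z₀ = z₁ = 0 and
--   Tᵏ(x₀) = n β^(k−L) + w z_k − u z_(k+1) + z_(k+2)   (k ≤ L).
-- As long as the driving term n β^(k−L) is present, induction gives z_k ≤ 0 and −w z_k ≤ n β^(k−L).
-- From time L on, n is absorbed in z_(L+2) and the carries satisfy 0 ≤ w z_k − u z_(k+1) + z_(k+2) < 1.
-- Iterating this three times bounds z_(k+4) in terms of z_k and z_(k+1) by a contraction,
-- hence eventually |z_k − 1| ≤ 4, and a finite search shows that the carries become constantly 0 or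
-- constantly 1.  The constant 1 has no predecessor but 1, so it would force z_L = 1, against z_L ≤ 0;
-- and constant carries 0 mean that the expansion of n is finite.
--
-- The constant carries 1 belong to φ = (t−1)/(β−1), whose expansion is (t−1)(t−1)(t−1)⋯.
-- As φ is a polynomial in 1/β with nonnegative coefficients, (PF) fails.

{-# OPTIONS --safe #-}
module Submission where

open import Defs
open import Data.Nat as ℕ using (ℕ; zero; suc; _≤_)
import Data.Nat.Properties as ℕₚ
open import Data.Integer as ℤ using (ℤ; +_; -[1+_]; +[1+_])
import Data.Integer.Properties as ℤₚ
open import Data.Empty using (⊥; ⊥-elim)
open import Data.List using (List; []; _∷_; map; upTo; _++_)
open import Data.List.Membership.Propositional using (_∈_)
open import Data.List.Membership.Propositional.Properties using (∈-map⁺; ∈-++⁺ˡ; ∈-++⁺ʳ; ∈-upTo⁺)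
open import Data.List.Relation.Unary.All as All using (All)
open import Data.Maybe using (Maybe; just; nothing)
open import Data.Product using (Σ; _×_; _,_; proj₁; proj₂)
open import Data.Sum using (_⊎_; inj₁; inj₂)
open import Data.Unit using (tt)
open import Relation.Nullary using (¬_; Dec; yes; no; _×-dec_; _⊎-dec_)
open import Relation.Nullary.Decidable using (toWitness)
open import Relation.Unary using (Decidable)
open import Relation.Binary.Definitions using (tri<; tri≈; tri>)
open import Relation.Binary.PropositionalEquality as ≡ using (_≡_)
open import Relation.Binary.Structures using (IsStrictTotalOrder)
open import Algebra.Bundles using (CommutativeRing)
open import Algebra.Solver.Ring.AlmostCommutativeRing
  using (fromCommutativeRing; _-Raw-AlmostCommutative⟶_)
import Algebra.Solver.Ring as RingSolver
import Algebra.Properties.Ring as RingProperties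
import Algebra.Properties.Semiring.Mult as SemiringMult
import Relation.Binary.Reasoning.Setoid as SetoidReasoning

-- Integers in a commutative ring, and a ring solver with integer constants.

module IntegerEmbedding {c ℓ} (R : CommutativeRing c ℓ) where
  open CommutativeRing R
  open RingOps R
  open RingProperties ring
  open SemiringMult semiring using (×-homo-+; ×1-homo-*) renaming (_×_ to _⊗_)
  open SetoidReasoning setoid

  -- Identifies `fromℕ` with the multiples of `1#`, so that their homomorphism laws apply.
  fromℕ≡⊗1 : ∀ n → fromℕ n ≡ n ⊗ 1#
  fromℕ≡⊗1 zero    = ≡.refl
  fromℕ≡⊗1 (suc n) = ≡.cong (λ x → 1# + x) (fromℕ≡⊗1 n)

  fromℕ-+ : ∀ m n → fromℕ (m ℕ.+ n) ≈ fromℕ m + fromℕ n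
  fromℕ-+ m n rewrite fromℕ≡⊗1 (m ℕ.+ n) | fromℕ≡⊗1 m | fromℕ≡⊗1 n = ×-homo-+ 1# m n

  fromℕ-* : ∀ m n → fromℕ (m ℕ.* n) ≈ fromℕ m * fromℕ n
  fromℕ-* m n rewrite fromℕ≡⊗1 (m ℕ.* n) | fromℕ≡⊗1 m | fromℕ≡⊗1 n = ×1-homo-* m n

  fromℤ-⊖ : ∀ m n → fromℤ (m ℤ.⊖ n) ≈ fromℕ m + - fromℕ n
  fromℤ-⊖ zero    zero    = sym (-‿inverseʳ 0#)
  fromℤ-⊖ zero    (suc n) = sym (+-identityˡ _)
  fromℤ-⊖ (suc m) zero    = sym (trans (+-congˡ -0#≈0#) (+-identityʳ _))
  fromℤ-⊖ (suc m) (suc n) = begin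
    fromℤ (suc m ℤ.⊖ suc n)                     ≡⟨ ≡.cong fromℤ (ℤₚ.[1+m]⊖[1+n]≡m⊖n m n) ⟩
    fromℤ (m ℤ.⊖ n)                             ≈⟨ fromℤ-⊖ m n ⟩
    fromℕ m + - fromℕ n                         ≈⟨ +-congʳ (trans (+-congˡ (-‿inverseʳ 1#)) (+-identityʳ _)) ⟨
    fromℕ m + (1# + - 1#) + - fromℕ n           ≈⟨ +-congʳ (trans (+-congʳ (+-comm _ _)) (+-assoc _ _ _)) ⟨
    1# + fromℕ m + - 1# + - fromℕ n             ≈⟨ +-assoc _ _ _ ⟩
    1# + fromℕ m + (- 1# + - fromℕ n)           ≈⟨ +-congˡ (-‿+-comm _ _) ⟩
    1# + fromℕ m + - (1# + fromℕ n)             ∎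

  fromℤ-neg : ∀ i → fromℤ (ℤ.- i) ≈ - fromℤ i
  fromℤ-neg (+ zero)  = sym -0#≈0#
  fromℤ-neg +[1+ n ]  = refl
  fromℤ-neg -[1+ n ]  = sym (-‿involutive _)

  fromℤ-+ : ∀ i j → fromℤ (i ℤ.+ j) ≈ fromℤ i + fromℤ j
  fromℤ-+ (+ m)    (+ n)    = fromℕ-+ m n
  fromℤ-+ (+ m)    -[1+ n ] = fromℤ-⊖ m (suc n)
  fromℤ-+ -[1+ m ] (+ n)    = trans (fromℤ-⊖ n (suc m)) (+-comm _ _)
  fromℤ-+ -[1+ m ] -[1+ n ] = begin
    - fromℕ (suc (suc (m ℕ.+ n)))      ≡⟨ ≡.cong (λ k → - fromℕ (suc k)) (ℕₚ.+-suc m n) ⟨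
    - fromℕ (suc m ℕ.+ suc n)          ≈⟨ -‿cong (fromℕ-+ (suc m) (suc n)) ⟩
    - (fromℕ (suc m) + fromℕ (suc n))  ≈⟨ -‿+-comm _ _ ⟨
    - fromℕ (suc m) + - fromℕ (suc n)  ∎

  private
    fromℤ-+* : ∀ m j → fromℤ (+ m ℤ.* j) ≈ fromℕ m * fromℤ j
    fromℤ-+* m (+ n) rewrite ≡.sym (ℤₚ.pos-* m n) = fromℕ-* m n
    fromℤ-+* m -[1+ n ] = begin
      fromℤ (+ m ℤ.* (ℤ.- + suc n))  ≡⟨ ≡.cong fromℤ (ℤₚ.neg-distribʳ-* (+ m) (+ suc n)) ⟨
      fromℤ (ℤ.- (+ m ℤ.* + suc n))  ≈⟨ fromℤ-neg (+ m ℤ.* + suc n) ⟩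
      - fromℤ (+ m ℤ.* + suc n)      ≈⟨ -‿cong (fromℤ-+* m (+ suc n)) ⟩
      - (fromℕ m * fromℕ (suc n))    ≈⟨ -‿distribʳ-* _ _ ⟩
      fromℕ m * - fromℕ (suc n)      ∎

  fromℤ-* : ∀ i j → fromℤ (i ℤ.* j) ≈ fromℤ i * fromℤ j
  fromℤ-* (+ m)    j = fromℤ-+* m j
  fromℤ-* -[1+ m ] j = begin
    fromℤ ((ℤ.- + suc m) ℤ.* j)    ≡⟨ ≡.cong fromℤ (ℤₚ.neg-distribˡ-* (+ suc m) j) ⟨
    fromℤ (ℤ.- (+ suc m ℤ.* j))    ≈⟨ fromℤ-neg (+ suc m ℤ.* j) ⟩
    - fromℤ (+ suc m ℤ.* j)        ≈⟨ -‿cong (fromℤ-+* (suc m) j) ⟩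
    - (fromℕ (suc m) * fromℤ j)    ≈⟨ -‿distribˡ-* _ _ ⟩
    - fromℕ (suc m) * fromℤ j      ∎

  -- Agrees with fromℤ, but maps 1 to 1# rather than to 1# + 0#, so that the
  -- solver may use the constant 1 for 1#.
  constant : ℤ → Carrier
  constant (+ 1) = 1#
  constant i     = fromℤ i

  constant≈fromℤ : ∀ i → constant i ≈ fromℤ i
  constant≈fromℤ (+ 0)           = refl
  constant≈fromℤ (+ 1)           = sym (+-identityʳ 1#)
  constant≈fromℤ (+ suc (suc n)) = refl
  constant≈fromℤ -[1+ n ]        = refl

  private
    morphism : CommutativeRing.rawRing ℤₚ.+-*-commutativeRing
                 -Raw-AlmostCommutative⟶ fromCommutativeRing R
    morphism = record
      { ⟦_⟧    = constant
      ; +-homo = λ i j → trans (constant≈fromℤ (i ℤ.+ j))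
          (trans (fromℤ-+ i j) (sym (+-cong (constant≈fromℤ i) (constant≈fromℤ j))))
      ; *-homo = λ i j → trans (constant≈fromℤ (i ℤ.* j))
          (trans (fromℤ-* i j) (sym (*-cong (constant≈fromℤ i) (constant≈fromℤ j))))
      ; -‿homo = λ i → trans (constant≈fromℤ (ℤ.- i))
          (trans (fromℤ-neg i) (sym (-‿cong (constant≈fromℤ i))))
      ; 0-homo = refl
      ; 1-homo = refl
      }

    constant-≟ : ∀ i j → Maybe (constant i ≈ constant j)
    constant-≟ i j with i ℤ.≟ j
    ... | yes ≡.refl = just refl
    -- Distinct integers may still agree in the ring; the solver only needs the positive answers to
    -- be sound.
    ... | no _       = nothing

  module Solver = RingSolver (CommutativeRing.rawRing ℤₚ.+-*-commutativeRing)
                             (fromCommutativeRing R) morphism constant-≟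

-- Floor fields

module FloorFieldProperties {c ℓ r} (F : FloorField c ℓ r) where
  open FloorField F
  open CommutativeRing cring
  open Beta F using () renaming (_≤_ to _≤ᶠ_)
  open RingOps cring
  open IntegerEmbedding cring
  open IsStrictTotalOrder isStrictTotalOrder public
    using (compare; <-resp-≈; _<?_) renaming (irrefl to <-irrefl; trans to <-trans)
  open Solver

  -- Inequalities are mostly carried as signs of differences: a ring identity then writes the
  -- difference as a sum of products of known sign.
  Pos NonNeg : Carrier → Set _
  Pos x = 0# < x
  NonNeg x = 0# ≤ᶠ x

  <-resp : ∀ {x x′ y y′} → x ≈ x′ → y ≈ y′ → x < y → x′ < y′
  <-resp x≈x′ y≈y′ x<y = proj₂ <-resp-≈ x≈x′ (proj₁ <-resp-≈ y≈y′ x<y)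

  pos-resp : ∀ {x y} → x ≈ y → Pos x → Pos y
  pos-resp = <-resp refl

  nonNeg-resp : ∀ {x y} → x ≈ y → NonNeg x → NonNeg y
  nonNeg-resp x≈y (inj₁ 0<x) = inj₁ (pos-resp x≈y 0<x)
  nonNeg-resp x≈y (inj₂ 0≈x) = inj₂ (trans 0≈x x≈y)

  <⇒pos : ∀ {x y} → x < y → Pos (y + - x)
  <⇒pos {x} x<y = <-resp (-‿inverseʳ x) refl (+-mono-< (- x) x<y)

  pos⇒< : ∀ {x y} → Pos (y + - x) → x < y
  pos⇒< {x} {y} p = <-resp (+-identityˡ x)
    (solve 2 (λ x y → (y :- x) :+ x := y) refl x y) (+-mono-< x p)

  ≤⇒nonNeg : ∀ {x y} → x ≤ᶠ y → NonNeg (y + - x)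
  ≤⇒nonNeg (inj₁ x<y) = inj₁ (<⇒pos x<y)
  ≤⇒nonNeg {x} (inj₂ x≈y) = inj₂ (sym (trans (+-congʳ (sym x≈y)) (-‿inverseʳ x)))

  nonNeg⇒≤ : ∀ {x y} → NonNeg (y + - x) → x ≤ᶠ y
  nonNeg⇒≤ (inj₁ p) = inj₁ (pos⇒< p)
  nonNeg⇒≤ {x} {y} (inj₂ 0≈y-x) = inj₂ (trans (sym (+-identityˡ x))
    (trans (+-congʳ 0≈y-x) (solve 2 (λ x y → (y :- x) :+ x := y) refl x y)))

  pos+pos : ∀ {x y} → Pos x → Pos y → Pos (x + y)
  pos+pos {x} {y} 0<x 0<y = <-trans 0<y (<-resp (+-identityˡ y) refl (+-mono-< y 0<x))

  pos+nonNeg : ∀ {x y} → Pos x → NonNeg y → Pos (x + y)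
  pos+nonNeg 0<x (inj₁ 0<y) = pos+pos 0<x 0<y
  pos+nonNeg 0<x (inj₂ 0≈y) = pos-resp (trans (sym (+-identityʳ _)) (+-congˡ 0≈y)) 0<x

  nonNeg+pos : ∀ {x y} → NonNeg x → Pos y → Pos (x + y)
  nonNeg+pos 0≤x 0<y = pos-resp (+-comm _ _) (pos+nonNeg 0<y 0≤x)

  nonNeg+nonNeg : ∀ {x y} → NonNeg x → NonNeg y → NonNeg (x + y)
  nonNeg+nonNeg (inj₁ 0<x) 0≤y = inj₁ (pos+nonNeg 0<x 0≤y)
  nonNeg+nonNeg (inj₂ 0≈x) 0≤y = nonNeg-resp (trans (sym (+-identityˡ _)) (+-congʳ 0≈x)) 0≤y

  nonNeg*nonNeg : ∀ {x y} → NonNeg x → NonNeg y → NonNeg (x * y)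
  nonNeg*nonNeg (inj₁ 0<x) (inj₁ 0<y) = inj₁ (*-pos 0<x 0<y)
  nonNeg*nonNeg {x} (inj₁ _) (inj₂ 0≈y) = inj₂ (trans (sym (zeroʳ x)) (*-congˡ 0≈y))
  nonNeg*nonNeg {_} {y} (inj₂ 0≈x) _ = inj₂ (trans (sym (zeroˡ y)) (*-congʳ 0≈x))

  pos⇒¬nonPos : ∀ {x} → Pos x → ¬ NonNeg (- x)
  pos⇒¬nonPos {x} 0<x 0≤-x = <-irrefl (sym (-‿inverseʳ x)) (pos+nonNeg 0<x 0≤-x)

  square-nonNeg : ∀ x → NonNeg (x * x)
  square-nonNeg x with compare 0# x
  ... | tri< 0<x _ _ = inj₁ (*-pos 0<x 0<x)
  ... | tri≈ _ 0≈x _ = inj₂ (trans (sym (zeroˡ x)) (*-congʳ 0≈x))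
  ... | tri> _ _ x<0 = inj₁ (pos-resp
        (solve 1 (λ x → (con (+ 0) :- x) :* (con (+ 0) :- x) := x :* x) refl x)
        (*-pos (<⇒pos x<0) (<⇒pos x<0)))

  -- The tool for bounding fractions: the estimate is first multiplied by a positive denominator.
  pos-cancelʳ : ∀ {x y} → Pos y → Pos (x * y) → Pos x
  pos-cancelʳ {x} {y} 0<y 0<xy with compare 0# x
  ... | tri< 0<x _ _ = 0<x
  ... | tri≈ _ 0≈x _ = ⊥-elim (<-irrefl (trans (sym (zeroˡ y)) (*-congʳ 0≈x)) 0<xy)
  ... | tri> _ _ x<0 = ⊥-elim (pos⇒¬nonPos 0<xy (nonNeg-resp
        (solve 2 (λ x y → (con (+ 0) :- x) :* y := :- (x :* y)) refl x y)
        (inj₁ (*-pos (<⇒pos x<0) 0<y))))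

  fromℕ-nonNeg : ∀ n → NonNeg (fromℕ n)
  fromℕ-nonNeg zero    = inj₂ refl
  fromℕ-nonNeg (suc n) = inj₁ (pos+nonNeg 0<1 (fromℕ-nonNeg n))

  fromℕ-pos : ∀ n → Pos (fromℕ (suc n))
  fromℕ-pos n = pos+nonNeg 0<1 (fromℕ-nonNeg n)

  fromℤ-nonNeg : ∀ {i} → + 0 ℤ.≤ i → NonNeg (fromℤ i)
  fromℤ-nonNeg {+ n} _ = fromℕ-nonNeg n

  fromℤ-pos : ∀ {i} → + 0 ℤ.< i → Pos (fromℤ i)
  fromℤ-pos {+[1+ n ]} _ = fromℕ-pos n
  fromℤ-pos {+ zero} (ℤ.+<+ ())

  fromℤ-- : ∀ i j → fromℤ (i ℤ.- j) ≈ fromℤ i + - fromℤ j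
  fromℤ-- i j = trans (fromℤ-+ i (ℤ.- j)) (+-congˡ (fromℤ-neg j))

  fromℤ-mono-≤ : ∀ {i j} → i ℤ.≤ j → fromℤ i ≤ᶠ fromℤ j
  fromℤ-mono-≤ {i} {j} i≤j =
    nonNeg⇒≤ (nonNeg-resp (fromℤ-- j i) (fromℤ-nonNeg (ℤₚ.i≤j⇒0≤j-i i≤j)))

  fromℤ-mono-< : ∀ {i j} → i ℤ.< j → fromℤ i < fromℤ j
  fromℤ-mono-< {i} {j} i<j = pos⇒< (pos-resp (fromℤ-- j i) (fromℤ-pos
    (≡.subst (ℤ._< j ℤ.- i) (ℤₚ.+-inverseʳ i) (ℤₚ.+-monoˡ-< (ℤ.- i) i<j))))

  fromℤ-cancel-< : ∀ {i j} → fromℤ i < fromℤ j → i ℤ.< j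
  fromℤ-cancel-< {i} {j} i<j = ℤₚ.≰⇒> λ j≤i → pos⇒¬nonPos (<⇒pos i<j) (nonNeg-resp
    (solve 2 (λ i j → i :- j := :- (j :- i)) refl (fromℤ i) (fromℤ j))
    (≤⇒nonNeg (fromℤ-mono-≤ j≤i)))

  fromℤ-cancel-≤ : ∀ {i j} → fromℤ i < (fromℤ j + 1#) → i ℤ.≤ j
  fromℤ-cancel-≤ {i} {j} i<j+1 = ℤₚ.≮⇒≥ λ j<i → ℤₚ.<⇒≱
    (fromℤ-cancel-< {i} {ℤ.suc j} (<-resp refl
      (trans (+-comm _ _) (trans (+-congʳ (constant≈fromℤ (+ 1))) (sym (fromℤ-+ (+ 1) j)))) i<j+1))
    (ℤₚ.i<j⇒suc[i]≤j j<i)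

  between-0-and-1 : ∀ {i} → NonNeg (fromℤ i) → Pos (1# + - fromℤ i) → i ≡ + 0
  between-0-and-1 {i} 0≤i i<1 = ℤₚ.≤-antisym
    (fromℤ-cancel-≤ (<-resp refl (sym (+-identityˡ 1#)) (pos⇒< i<1)))
    (fromℤ-cancel-≤ (pos⇒< (pos-resp (solve 1 (λ i → con (+ 1) :+ i := (i :+ con (+ 1)) :- con (+ 0)) refl (fromℤ i))
      (pos+nonNeg 0<1 0≤i))))

  fromℕ-mono-≤ : ∀ {m n} → m ℕ.≤ n → NonNeg (fromℕ n + - fromℕ m)
  fromℕ-mono-≤ m≤n = ≤⇒nonNeg (fromℤ-mono-≤ (ℤ.+≤+ m≤n))

  fromℕ-cancel-< : ∀ {m n} → Pos (fromℕ n + - fromℕ m) → m ℕ.< n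
  fromℕ-cancel-< m<n = ℤₚ.drop‿+<+ (fromℤ-cancel-< (pos⇒< m<n))

  private
    ∣i∣≤n⇒i≤n : ∀ {n} i → ℤ.∣ i ∣ ℕ.≤ n → NonNeg (fromℕ n + - fromℤ i)
    ∣i∣≤n⇒i≤n (+ m) m≤n = fromℕ-mono-≤ m≤n
    ∣i∣≤n⇒i≤n {n} -[1+ m ] _ = nonNeg-resp (solve 2 (λ x y → x :+ y := x :- (:- y)) refl (fromℕ n) (fromℕ (suc m)))
      (nonNeg+nonNeg (fromℕ-nonNeg n) (fromℕ-nonNeg (suc m)))

    i<1+n⇒∣i∣≤n : ∀ {n} i → Pos (fromℕ (suc n) + - fromℤ i) → Pos (fromℕ (suc n) + fromℤ i) → ℤ.∣ i ∣ ℕ.≤ n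
    i<1+n⇒∣i∣≤n (+ m)    p _ = ℕₚ.≤-pred (fromℕ-cancel-< p)
    i<1+n⇒∣i∣≤n -[1+ m ] _ p = ℕₚ.≤-pred (fromℕ-cancel-< p)

    fromℤ-pred : ∀ i → fromℤ (i ℤ.- + 1) ≈ fromℤ i + - 1#
    fromℤ-pred i = trans (fromℤ-- i (+ 1)) (+-congˡ (-‿cong (sym (constant≈fromℤ (+ 1)))))

  near-1⇒ : ∀ {n} i → ℤ.∣ i ℤ.- + 1 ∣ ℕ.≤ n →
            NonNeg (fromℕ n + 1# + - fromℤ i) × NonNeg (fromℕ n + - 1# + fromℤ i)
  near-1⇒ {n} i ∣i-1∣≤n =
      nonNeg-resp (trans (+-congˡ (-‿cong (fromℤ-pred i)))
          (solve 2 (λ n i → n :- (i :- con (+ 1)) := n :+ con (+ 1) :- i) refl (fromℕ n) (fromℤ i)))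
        (∣i∣≤n⇒i≤n (i ℤ.- + 1) ∣i-1∣≤n)
    , nonNeg-resp (trans (+-congˡ (-‿cong (trans (fromℤ-neg (i ℤ.- + 1)) (-‿cong (fromℤ-pred i)))))
          (solve 2 (λ n i → n :- (:- (i :- con (+ 1))) := n :- con (+ 1) :+ i) refl (fromℕ n) (fromℤ i)))
        (∣i∣≤n⇒i≤n (ℤ.- (i ℤ.- + 1)) (≡.subst (ℕ._≤ n) (≡.sym (ℤₚ.∣-i∣≡∣i∣ (i ℤ.- + 1))) ∣i-1∣≤n))

  -- Integrality improves the strict bound `suc n` to `n`; so the contraction of the carries gains a
  -- full unit each time.
  near-1⇐ : ∀ {n} i → Pos (fromℕ (suc n) + 1# + - fromℤ i) → Pos (fromℕ (suc n) + - 1# + fromℤ i) →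
            ℤ.∣ i ℤ.- + 1 ∣ ℕ.≤ n
  near-1⇐ {n} i p q = i<1+n⇒∣i∣≤n (i ℤ.- + 1)
    (pos-resp (trans
        (solve 2 (λ n i → n :+ con (+ 1) :- i := n :- (i :- con (+ 1))) refl (fromℕ (suc n)) (fromℤ i))
        (+-congˡ (-‿cong (sym (fromℤ-pred i))))) p)
    (pos-resp (trans
        (solve 2 (λ n i → n :- con (+ 1) :+ i := n :+ (i :- con (+ 1))) refl (fromℕ (suc n)) (fromℤ i))
        (+-congˡ (sym (fromℤ-pred i)))) q)

  ≤-<-trans : ∀ {x y z} → x ≤ᶠ y → y < z → x < z
  ≤-<-trans (inj₁ x<y) y<z = <-trans x<y y<z
  ≤-<-trans (inj₂ x≈y) y<z = <-resp (sym x≈y) refl y<z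

  -- `FloorField` assumes no congruence of `⌊_⌋` for `≈`; digits of equal numbers are compared
  -- through this characterisation.
  floor-unique : ∀ {x} i → fromℤ i ≤ᶠ x → x < (fromℤ i + 1#) → ⌊ x ⌋ ≡ i
  floor-unique {x} i i≤x x<i+1 = ℤₚ.≤-antisym
    (fromℤ-cancel-≤ (≤-<-trans (floor-≤ x) x<i+1))
    (fromℤ-cancel-≤ (≤-<-trans i≤x (floor-< x)))

  -- Reduces x ≈ y modulo the relation a ≈ b to a ring identity: x − y = k (a − b).
  ≈-mod : ∀ {x y a b} k → a ≈ b → x + k * b ≈ y + k * a → x ≈ y
  ≈-mod {x} {y} {a} {b} k a≈b eq = trans
    (solve 3 (λ x k b → x := (x :+ k :* b) :- k :* b) refl x k b)
    (trans (+-cong eq (-‿cong (*-congˡ (sym a≈b))))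
      (solve 3 (λ y k a → (y :+ k :* a) :- k :* a := y) refl y k a))

least : ∀ {p} {P : ℕ → Set p} → Decidable P → ∀ n → P n → Σ ℕ λ m → P m × (∀ k → k ℕ.< m → ¬ P k)
least P? n Pn with P? 0
least P? n       Pn | yes P0 = 0 , P0 , λ _ ()
least P? zero    Pn | no ¬P0 = ⊥-elim (¬P0 Pn)
least P? (suc n) Pn | no ¬P0 with least (λ k → P? (suc k)) n Pn
... | m , Pm , minimal = suc m , Pm , λ where
  zero    _              → ¬P0
  (suc k) (ℕ.s≤s k<m) → minimal k k<m

-- Orbits of the beta-transformation and their digits.

module BetaTransformation {c ℓ r} (F : FloorField c ℓ r) (β : Car F) where
  open FloorField F
  open CommutativeRing cring
  open RingOps cring
  open IntegerEmbedding cring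
  open FloorFieldProperties F
  open Beta F using (T; Tⁿ; digit)
  open Solver

  T-nonNeg : ∀ y → NonNeg (T β y)
  T-nonNeg y = ≤⇒nonNeg (floor-≤ (β * y))

  T<1 : ∀ y → Pos (1# + - T β y)
  T<1 y = pos-resp (solve 2 (λ x f → (f :+ con (+ 1)) :- x := con (+ 1) :- (x :- f)) refl (β * y) (fromℤ ⌊ β * y ⌋))
    (<⇒pos (floor-< (β * y)))

  Tⁿ-nonNeg : ∀ {y} → NonNeg y → ∀ k → NonNeg (Tⁿ β k y)
  Tⁿ-nonNeg 0≤y zero    = 0≤y
  Tⁿ-nonNeg 0≤y (suc k) = T-nonNeg _

  Tⁿ<1 : ∀ {y} → Pos (1# + - y) → ∀ k → Pos (1# + - Tⁿ β k y)
  Tⁿ<1 y<1 zero    = y<1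
  Tⁿ<1 y<1 (suc k) = T<1 _

  Tⁿ-+ : ∀ j k y → Tⁿ β (j ℕ.+ k) y ≡ Tⁿ β j (Tⁿ β k y)
  Tⁿ-+ zero    k y = ≡.refl
  Tⁿ-+ (suc j) k y = ≡.cong (T β) (Tⁿ-+ j k y)

  digit-unique : ∀ {x y} i → β * x ≈ fromℤ i + y → NonNeg y → Pos (1# + - y) → ⌊ β * x ⌋ ≡ i
  digit-unique {x} {y} i eq 0≤y y<1 = floor-unique i
    (nonNeg⇒≤ (nonNeg-resp (sym (trans (+-congʳ eq) (solve 2 (λ i y → i :+ y :- i := y) refl (fromℤ i) y))) 0≤y))
    (pos⇒< (pos-resp (sym (trans (+-congˡ (-‿cong eq))
      (solve 2 (λ i y → (i :+ con (+ 1)) :- (i :+ y) := con (+ 1) :- y) refl (fromℤ i) y))) y<1))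

  -- Applied to 0 with digit 0, for finite expansions, and to φ with digit t - 1, for the failure of
  -- (PF).
  module FixedPoint {y} (i : ℤ) (βy≈i+y : β * y ≈ fromℤ i + y) (0≤y : NonNeg y) (y<1 : Pos (1# + - y)) where

    fixed-digit : ∀ {x} → x ≈ y → ⌊ β * x ⌋ ≡ i
    fixed-digit x≈y = digit-unique i (trans (*-congˡ x≈y) βy≈i+y) 0≤y y<1

    Tⁿ-fixed : ∀ {x} → x ≈ y → ∀ k → Tⁿ β k x ≈ y
    Tⁿ-fixed x≈y zero    = x≈y
    Tⁿ-fixed {x} x≈y (suc k) = trans
      (+-cong (trans (*-congˡ (Tⁿ-fixed x≈y k)) βy≈i+y)
        (-‿cong (reflexive (≡.cong fromℤ (fixed-digit (Tⁿ-fixed x≈y k))))))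
      (solve 2 (λ i y → i :+ y :- i := y) refl (fromℤ i) y)

    digit-fixed : ∀ {x} → x ≈ y → ∀ k → digit β k x ≡ i
    digit-fixed x≈y k = fixed-digit (Tⁿ-fixed x≈y k)

  open FixedPoint {0#} (+ 0) (trans (zeroʳ β) (sym (+-identityˡ 0#))) (inj₂ refl)
    (pos-resp (solve 0 (con (+ 1) := con (+ 1) :- con (+ 0)) refl) 0<1) public
    using () renaming (digit-fixed to digits-of-0)

  vanishing⇒finite : ∀ {y} k → Tⁿ β k y ≈ 0# → Beta.FiniteDigits F β y
  vanishing⇒finite {y} k Tᵏy≈0 = k , λ l k≤l → ≡.subst (λ m → digit β m y ≡ + 0) (ℕₚ.m∸n+n≡m k≤l)
    (≡.trans (≡.cong (λ x → ⌊ β * x ⌋) (Tⁿ-+ (l ℕ.∸ k) k y)) (digits-of-0 Tᵏy≈0 (l ℕ.∸ k)))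

-- The finite search

-- The corners are the values (at the last two vertices: twice the values) of 2 (w i − u j + k) at the
-- vertices (e , h) = (0 , 0), (0 , 1/2), (1/2 , 1/2) of a triangle that contains the point
-- (2u − 2 , 2w − 1) in its interior.
corner₁ corner₂ corner₃ : ℤ → ℤ → ℤ → ℤ
corner₁ i j k = + 2 ℤ.* k ℤ.+ i ℤ.- + 2 ℤ.* j
corner₂ i j k = + 2 ℤ.* corner₁ i j k ℤ.+ i
corner₃ i j k = corner₂ i j k ℤ.- j

-- The corner values force w i − u j + k < 0 (first case) or w i − u j + k ≥ 1 (second case).
Excluded : ℤ → ℤ → ℤ → Set
Excluded i j k =
  (corner₁ i j k ℤ.< + 0 × corner₂ i j k ℤ.≤ + 0 × corner₃ i j k ℤ.≤ + 0) ⊎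
  (+ 2 ℤ.≤ corner₁ i j k × + 4 ℤ.≤ corner₂ i j k × + 4 ℤ.≤ corner₃ i j k)

excluded? : ∀ i j k → Dec (Excluded i j k)
excluded? i j k =
  ((corner₁ i j k ℤ.<? + 0) ×-dec (corner₂ i j k ℤ.≤? + 0) ×-dec (corner₃ i j k ℤ.≤? + 0)) ⊎-dec
  ((+ 2 ℤ.≤? corner₁ i j k) ×-dec (+ 4 ℤ.≤? corner₂ i j k) ×-dec (+ 4 ℤ.≤? corner₃ i j k))

-- The integers from -3 to 5, those at distance at most 4 from 1.
window : List ℤ
window = map (ℤ._+ + 1) (map +_ (upTo 5) ++ map -[1+_] (upTo 4))

∈-window : ∀ i → ℤ.∣ i ℤ.- + 1 ∣ ℕ.≤ 4 → i ∈ window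
∈-window i ∣i-1∣≤4 = ≡.subst (_∈ window) i-1+1≡i (∈-map⁺ (ℤ._+ + 1) (∈-symmetric (i ℤ.- + 1) ∣i-1∣≤4))
  where
  i-1+1≡i : i ℤ.- + 1 ℤ.+ + 1 ≡ i
  i-1+1≡i = ≡.trans (ℤₚ.+-assoc i (ℤ.- + 1) (+ 1)) (ℤₚ.+-identityʳ i)

  ∈-symmetric : ∀ j → ℤ.∣ j ∣ ℕ.≤ 4 → j ∈ map +_ (upTo 5) ++ map -[1+_] (upTo 4)
  ∈-symmetric (+ m)    m≤4 = ∈-++⁺ˡ (∈-map⁺ +_ (∈-upTo⁺ (ℕ.s≤s m≤4)))
  ∈-symmetric -[1+ m ] m<4 = ∈-++⁺ʳ (map +_ (upTo 5)) (∈-map⁺ -[1+_] (∈-upTo⁺ m<4))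

-- The tree of possible continuations of two consecutive carries. `n` bounds its depth, and `⊥` at
-- depth 0 makes running out of depth a failure.
Settles : ℕ → ℤ → ℤ → Set
Settles zero    i j = ⊥
Settles (suc n) i j = (i ≡ + 0 × j ≡ + 0) ⊎ (i ≡ + 1 × j ≡ + 1) ⊎
  All (λ k → Excluded i j k ⊎ Settles n j k) window

settles? : ∀ n i j → Dec (Settles n i j)
settles? zero    i j = no λ ()
settles? (suc n) i j =
  ((i ℤ.≟ + 0) ×-dec (j ℤ.≟ + 0)) ⊎-dec ((i ℤ.≟ + 1) ×-dec (j ℤ.≟ + 1)) ⊎-dec
  All.all? (λ k → excluded? i j k ⊎-dec settles? n j k) window

-- The search depth is abstract because unfolding Settles at a literal depth explodes.
abstract
  depth : ℕ
  depth = 24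

  -- Decided by evaluation. `Excluded` does not involve t, so one search from 81 pairs serves every
  -- t.
  all-settle : All (λ i → All (Settles depth i) window) window
  all-settle = toWitness {a? = All.all? (λ i → All.all? (settles? depth i) window) window} tt

-- Constants attached to the cubic root

module CubicRoot {c ℓ r} (F : FloorField c ℓ r) (t : ℕ) (2≤t : 2 ≤ t) (β : Car F)
  (1<β : Beta.GreaterThanOne F β) (β-root : Beta.IsRootOfCubic F β t) where
  open FloorField F
  open CommutativeRing cring
  open RingOps cring
  open IntegerEmbedding cring
  open FloorFieldProperties F
  open Beta F using (Tⁿ; digit; FiniteDigits; PropF1; PropPF; evalInv)
  open BetaTransformation F β
  open Solver

  private
    κ : ℕ → Carrier
    κ n = constant (+ n)

    τ s : Carrier
    τ = fromℕ t
    s = inv β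

    βs≈1 : β * s ≈ 1#
    βs≈1 = inv-correct β λ β≈0 → <-irrefl (sym β≈0) (<-trans 0<1 1<β)

    root : β * β * β + - (κ 2 * τ * (β * β)) + κ 2 * τ * β + - τ ≈ 0#
    root = trans (solve 2 (λ τ β →
        β :* β :* β :- con (+ 2) :* τ :* (β :* β) :+ con (+ 2) :* τ :* β :- τ
        := β :* (β :* (β :* con (+ 1))) :- con (+ 2) :* τ :* (β :* (β :* con (+ 1))) :+ con (+ 2) :* τ :* β :- τ)
        refl τ β)
      (trans (+-congʳ (+-cong (+-congˡ (-‿cong (*-congʳ 2τ))) (*-congʳ 2τ))) β-root)
      where
      2τ : κ 2 * τ ≈ fromℕ (2 ℕ.* t)
      2τ = sym (fromℕ-* 2 t)

    2≤τ : NonNeg (τ + - κ 2)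
    2≤τ = fromℕ-mono-≤ 2≤t

    0<β-1 : Pos (β + - 1#)
    0<β-1 = <⇒pos 1<β

  κ-pos : ∀ n → Pos (κ (suc n))
  κ-pos n = pos-resp (sym (constant≈fromℤ (+ suc n))) (fromℕ-pos n)

  w u : Carrier
  w = τ * s
  u = κ 2 * τ + - β

  wβ : w * β ≈ τ
  wβ = ≈-mod τ βs≈1 (solve 3 (λ τ β s → τ :* s :* β :+ τ :* con (+ 1) := τ :+ τ :* (β :* s)) refl τ β s)

  -- This is the cubic divided by β.
  uβ : u * β ≈ κ 2 * τ + - w
  uβ = ≈-mod (- (κ 2 * τ * β + - (β * β) + - (κ 2 * τ))) βs≈1 (≈-mod (- s) root
    (solve 3 (λ τ β s → let k = :- (con (+ 2) :* τ :* β :- β :* β :- con (+ 2) :* τ) in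
      (con (+ 2) :* τ :- β) :* β :+ k :* con (+ 1) :+ (:- s) :* con (+ 0)
        := (con (+ 2) :* τ :- τ :* s) :+ k :* (β :* s)
           :+ (:- s) :* (β :* β :* β :- con (+ 2) :* τ :* (β :* β) :+ con (+ 2) :* τ :* β :- τ))
      refl τ β s))

  -- Both 2 w β and 2 τ equal β + u, so w is determined by β and u alone.
  2wβ : κ 2 * w * β ≈ β + u
  2wβ = ≈-mod (κ 2) wβ (solve 3 (λ τ β w →
    con (+ 2) :* w :* β :+ con (+ 2) :* τ := (β :+ (con (+ 2) :* τ :- β)) :+ con (+ 2) :* (w :* β))
    refl τ β w)

  w≈ : w ≈ β + u + - (u * β)
  w≈ = ≈-mod 1# uβ (solve 3 (λ τ β w → let u = con (+ 2) :* τ :- β in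
    w :+ con (+ 1) :* (con (+ 2) :* τ :- w) := (β :+ u :- u :* β) :+ con (+ 1) :* (u :* β))
    refl τ β w)

  q : Carrier
  q = κ 2 * (β * β) + - (κ 2 * β) + 1#

  -- Eliminating w from `2wβ` and `w≈` makes u a rational function of β, so that bounds on u become
  -- polynomial inequalities in β alone.
  uq : u * q ≈ κ 2 * (β * β) + - β
  uq = ≈-mod (κ 2 * β) w≈ (≈-mod (- 1#) 2wβ (solve 3 (λ u β w →
      u :* (con (+ 2) :* (β :* β) :- con (+ 2) :* β :+ con (+ 1)) :+ con (+ 2) :* β :* (β :+ u :- u :* β)
        :+ (:- con (+ 1)) :* (β :+ u)
      := (con (+ 2) :* (β :* β) :- β) :+ con (+ 2) :* β :* w :+ (:- con (+ 1)) :* (con (+ 2) :* w :* β))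
    refl u β w))

  β-pos : Pos β
  β-pos = pos-resp (solve 1 (λ β → (β :- con (+ 1)) :+ con (+ 1) := β) refl β) (pos+pos 0<β-1 0<1)

  q-pos : Pos q
  q-pos = pos-resp (solve 1 (λ β → con (+ 2) :* β :* (β :- con (+ 1)) :+ con (+ 1)
      := con (+ 2) :* (β :* β) :- con (+ 2) :* β :+ con (+ 1)) refl β)
    (pos+pos (*-pos (*-pos (κ-pos 1) β-pos) 0<β-1) 0<1)

  u>1 : Pos (u + - 1#)
  u>1 = pos-cancelʳ q-pos (pos-resp (sym (≈-mod 1# uq (solve 2 (λ u β →
      let q = con (+ 2) :* (β :* β) :- con (+ 2) :* β :+ con (+ 1) in
      (u :- con (+ 1)) :* q :+ con (+ 1) :* (con (+ 2) :* (β :* β) :- β)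
        := (β :- con (+ 1)) :+ con (+ 1) :* (u :* q)) refl u β))) 0<β-1)

  -- Start of a bootstrap through β = 2t - u with t ≥ 2: u < 2 gives β > 2, which gives u < 5/4,
  -- which gives β > 11/4.
  u<2 : Pos (κ 2 + - u)
  u<2 = pos-cancelʳ q-pos (pos-resp (sym (≈-mod (- 1#) uq (solve 2 (λ u β →
      let q = con (+ 2) :* (β :* β) :- con (+ 2) :* β :+ con (+ 1); b = β :- con (+ 1) in
      (con (+ 2) :- u) :* q :+ (:- con (+ 1)) :* (con (+ 2) :* (β :* β) :- β)
        := (con (+ 2) :* (b :* b) :+ b :+ con (+ 1)) :+ (:- con (+ 1)) :* (u :* q)) refl u β)))
    (pos+pos (pos+pos (*-pos (κ-pos 1) (*-pos 0<β-1 0<β-1)) 0<β-1) 0<1))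

  β>2 : Pos (β + - κ 2)
  β>2 = pos-resp (solve 2 (λ τ β → con (+ 2) :* (τ :- con (+ 2)) :+ (con (+ 2) :- (con (+ 2) :* τ :- β))
      := β :- con (+ 2)) refl τ β)
    (nonNeg+pos (nonNeg*nonNeg (inj₁ (κ-pos 1)) 2≤τ) u<2)

  u<5/4 : Pos (κ 5 + - (κ 4 * u))
  u<5/4 = pos-cancelʳ q-pos (pos-resp (sym (≈-mod (- κ 4) uq (solve 2 (λ u β →
      let q = con (+ 2) :* (β :* β) :- con (+ 2) :* β :+ con (+ 1); b = β :- con (+ 2) in
      (con (+ 5) :- con (+ 4) :* u) :* q :+ (:- con (+ 4)) :* (con (+ 2) :* (β :* β) :- β)
        := (con (+ 2) :* (b :* b) :+ con (+ 2) :* b :+ con (+ 1)) :+ (:- con (+ 4)) :* (u :* q)) refl u β)))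
    (pos+pos (pos+pos (*-pos (κ-pos 1) (*-pos β>2 β>2)) (*-pos (κ-pos 1) β>2)) 0<1))

  β>11/4 : Pos (κ 4 * β + - κ 11)
  β>11/4 = pos-resp (solve 2 (λ τ β → con (+ 8) :* (τ :- con (+ 2)) :+ (con (+ 5) :- con (+ 4) :* (con (+ 2) :* τ :- β))
      := con (+ 4) :* β :- con (+ 11)) refl τ β)
    (nonNeg+pos (nonNeg*nonNeg (inj₁ (κ-pos 7)) 2≤τ) u<5/4)

  u-pos : Pos u
  u-pos = pos-resp (solve 1 (λ u → (u :- con (+ 1)) :+ con (+ 1) := u) refl u) (pos+pos u>1 0<1)

  w>1/2 : Pos (κ 2 * w + - 1#)
  w>1/2 = pos-cancelʳ β-pos (pos-resp (sym (≈-mod 1# 2wβ (solve 3 (λ u β w →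
      (con (+ 2) :* w :- con (+ 1)) :* β :+ con (+ 1) :* (β :+ u)
        := u :+ con (+ 1) :* (con (+ 2) :* w :* β)) refl u β w))) u-pos)

  w<3/4 : Pos (κ 3 + - (κ 4 * w))
  w<3/4 = pos-cancelʳ (*-pos (κ-pos 3) β-pos) (pos-resp (sym (≈-mod (- κ 8) 2wβ (solve 3 (λ u β w →
      (con (+ 3) :- con (+ 4) :* w) :* (con (+ 4) :* β) :+ (:- con (+ 8)) :* (β :+ u)
        := (con (+ 4) :* β :- con (+ 11)) :+ con (+ 2) :* (con (+ 5) :- con (+ 4) :* u) :+ con (+ 1)
           :+ (:- con (+ 8)) :* (con (+ 2) :* w :* β)) refl u β w)))
    (pos+pos (pos+pos β>11/4 (*-pos (κ-pos 1) u<5/4)) 0<1))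

  -- In fact 2w - 2u + 1 = 1/`q`; the proof clears the denominators `q` and 2β.
  u-w<1/2 : Pos (κ 2 * w + - (κ 2 * u) + 1#)
  u-w<1/2 = pos-cancelʳ q-pos (pos-cancelʳ (*-pos (κ-pos 1) β-pos) (pos-resp (sym
    (≈-mod (κ 2 * q) 2wβ (≈-mod (κ 2 + - (κ 4 * β)) uq (solve 3 (λ u β w →
      let q = con (+ 2) :* (β :* β) :- con (+ 2) :* β :+ con (+ 1) in
      (con (+ 2) :* w :- con (+ 2) :* u :+ con (+ 1)) :* q :* (con (+ 2) :* β) :+ con (+ 2) :* q :* (β :+ u)
        :+ (con (+ 2) :- con (+ 4) :* β) :* (con (+ 2) :* (β :* β) :- β)
      := con (+ 2) :* β :+ con (+ 2) :* q :* (con (+ 2) :* w :* β)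
        :+ (con (+ 2) :- con (+ 4) :* β) :* (u :* q)) refl u β w))))
    (*-pos (κ-pos 1) β-pos)))

  w-pos : Pos w
  w-pos = pos-cancelʳ (κ-pos 1) (pos-resp (solve 1 (λ w → (con (+ 2) :* w :- con (+ 1)) :+ con (+ 1) := w :* con (+ 2)) refl w)
    (pos+pos w>1/2 0<1))

  u>w : Pos (u + - w)
  u>w = pos-cancelʳ (κ-pos 3) (pos-resp (solve 2 (λ u w →
      con (+ 4) :* (u :- con (+ 1)) :+ (con (+ 3) :- con (+ 4) :* w) :+ con (+ 1) := (u :- w) :* con (+ 4)) refl u w)
    (pos+pos (pos+pos (*-pos (κ-pos 3) u>1) w<3/4) 0<1))

  ws≈ : (κ 2 * w + - u) * β ≈ w
  ws≈ = ≈-mod (κ 2) wβ (≈-mod (- 1#) uβ (solve 4 (λ τ β u w →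
      (con (+ 2) :* w :- u) :* β :+ con (+ 2) :* τ :+ (:- con (+ 1)) :* (con (+ 2) :* τ :- w)
      := w :+ con (+ 2) :* (w :* β) :+ (:- con (+ 1)) :* (u :* β)) refl τ β u w))

  -- Multiply 2wβ = β + u by 2w - u and replace (2w - u)β by w on both sides.
  curve : w + κ 2 * (u * w) ≈ κ 2 * (w * w) + u * u
  curve = ≈-mod (- (κ 2 * w + - u)) 2wβ (≈-mod (κ 2 * w + - 1#) ws≈ (solve 3 (λ u w β →
      let k = con (+ 2) :* w :- u; l = con (+ 2) :* w :- con (+ 1) in
      w :+ con (+ 2) :* (u :* w) :+ (:- k) :* (β :+ u) :+ l :* w
      := con (+ 2) :* (w :* w) :+ u :* u :+ (:- k) :* (con (+ 2) :* w :* β) :+ l :* (k :* β)) refl u w β))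

  -- The coefficients in `fourth-carry`. By `curve`, `g` is u² - w in a visibly positive form; then
  -- `a` = u(w - g).
  g a b : Carrier
  g = κ 2 * w * (u + - w)
  a = u * w * (κ 2 * w + - (κ 2 * u) + 1#)
  b = w * g

  g-pos : Pos g
  g-pos = *-pos (*-pos (κ-pos 1) w-pos) u>w

  a-pos : Pos a
  a-pos = *-pos (*-pos u-pos w-pos) u-w<1/2

  b-pos : Pos b
  b-pos = *-pos w-pos g-pos

  -- Bounds 1 + u + g, the largest weight the three orbit points can contribute in `fourth-carry`,
  -- by 3.
  g+u<2 : Pos (κ 2 + - g + - u)
  g+u<2 = pos-cancelʳ (κ-pos 3) (pos-resp (solve 2 (λ u w →
      (con (+ 5) :- con (+ 4) :* u) :+ (con (+ 3) :- con (+ 4) :* w)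
        :+ con (+ 4) :* w :* (con (+ 2) :* w :- con (+ 2) :* u :+ con (+ 1))
      := (con (+ 2) :- con (+ 2) :* w :* (u :- w) :- u) :* con (+ 4)) refl u w)
    (pos+pos (pos+pos u<5/4 w<3/4) (*-pos (*-pos (κ-pos 3) w-pos) u-w<1/2)))

  -- The contraction factor. With d = 4(u - w) - 1 one has a + b = w² + w/8 - w d²/8, and w² + w/8 <
  -- 21/32 for w < 3/4.
  a+b<2/3 : Pos (κ 2 + - (κ 3 * (a + b)))
  a+b<2/3 = pos-cancelʳ (κ-pos 31) (pos-resp (solve 2 (λ u w →
      let y = con (+ 3) :- con (+ 4) :* w; g = con (+ 2) :* w :* (u :- w)
          d = con (+ 4) :* (u :- w) :- con (+ 1)
          a = u :* w :* (con (+ 2) :* w :- con (+ 2) :* u :+ con (+ 1)) in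
      con (+ 1) :+ con (+ 33) :* y :+ con (+ 12) :* y :* (con (+ 2) :* w :- con (+ 1)) :+ con (+ 12) :* w :* (d :* d)
      := (con (+ 2) :- con (+ 3) :* (a :+ w :* g)) :* con (+ 32)) refl u w)
    (pos+nonNeg (pos+pos (pos+pos 0<1 (*-pos (κ-pos 32) w<3/4)) (*-pos (*-pos (κ-pos 11) w<3/4) w>1/2))
      (nonNeg*nonNeg (inj₁ (*-pos (κ-pos 11) w-pos)) (square-nonNeg _))))

  -- Carries

  value : ℤ → ℤ → ℤ → Carrier
  value i j k = w * fromℤ i + - (u * fromℤ j) + fromℤ k

  -- Solve each of the three relations for its last carry and substitute successively; `curve`
  -- replaces the coefficient u² - w of the carry `i₂` by `g`.
  fourth-carry : ∀ {x₀ x₁ x₂} i₀ i₁ i₂ i₃ i₄ →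
    x₀ ≈ value i₀ i₁ i₂ → x₁ ≈ value i₁ i₂ i₃ → x₂ ≈ value i₂ i₃ i₄ →
    fromℤ i₄ ≈ x₂ + u * x₁ + g * x₀ + - (a * fromℤ i₁) + - (b * fromℤ i₀)
  fourth-carry {x₀} {x₁} {x₂} i₀ i₁ i₂ i₃ i₄ e₀ e₁ e₂ =
    ≈-mod (- 1#) e₂ (≈-mod (- u) e₁ (≈-mod (- g) e₀ (≈-mod (- fromℤ i₂) curve
      (solve 10 (λ u w z₀ z₁ z₂ z₃ z₄ x₀ x₁ x₂ →
        let g = con (+ 2) :* w :* (u :- w)
            a = u :* w :* (con (+ 2) :* w :- con (+ 2) :* u :+ con (+ 1))
            v = λ z₀ z₁ z₂ → w :* z₀ :- u :* z₁ :+ z₂ in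
        z₄ :+ (:- con (+ 1)) :* v z₂ z₃ z₄ :+ (:- u) :* v z₁ z₂ z₃ :+ (:- g) :* v z₀ z₁ z₂
           :+ (:- z₂) :* (con (+ 2) :* (w :* w) :+ u :* u)
        := (x₂ :+ u :* x₁ :+ g :* x₀ :- a :* z₁ :- (w :* g) :* z₀)
           :+ (:- con (+ 1)) :* x₂ :+ (:- u) :* x₁ :+ (:- g) :* x₀ :+ (:- z₂) :* (w :+ con (+ 2) :* (u :* w)))
        refl u w (fromℤ i₀) (fromℤ i₁) (fromℤ i₂) (fromℤ i₃) (fromℤ i₄) x₀ x₁ x₂))))

  -- Put C = 5 + m. By `fourth-carry`, the new carry lies strictly between -(2/3)(C + 1) and 3 +
  -- (2/3)(C - 1). This lies within 1 - C and 1 + C once C ≥ 5, the lower end being the critical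
  -- one.
  fourth-carry-near-1 : ∀ {x₀ x₁ x₂} m i₀ i₁ i₂ i₃ i₄ →
    x₀ ≈ value i₀ i₁ i₂ → x₁ ≈ value i₁ i₂ i₃ → x₂ ≈ value i₂ i₃ i₄ →
    NonNeg x₀ → NonNeg x₁ → NonNeg x₂ → Pos (1# + - x₀) → Pos (1# + - x₁) → Pos (1# + - x₂) →
    ℤ.∣ i₀ ℤ.- + 1 ∣ ℕ.≤ 5 ℕ.+ m → ℤ.∣ i₁ ℤ.- + 1 ∣ ℕ.≤ 5 ℕ.+ m → ℤ.∣ i₄ ℤ.- + 1 ∣ ℕ.≤ 4 ℕ.+ m
  fourth-carry-near-1 {x₀} {x₁} {x₂} m i₀ i₁ i₂ i₃ i₄ e₀ e₁ e₂ 0≤x₀ 0≤x₁ 0≤x₂ x₀<1 x₁<1 x₂<1 near₀ near₁ =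
    near-1⇐ i₄
      (pos-cancelʳ (κ-pos 2) (pos-resp
        (trans (solve 10 (λ C z₀ z₁ x₀ x₁ x₂ g u a b →
            let A = con (+ 2) :- con (+ 3) :* (a :+ b) in
            A :+ con (+ 3) :* a :* (C :- con (+ 1) :+ z₁) :+ con (+ 3) :* b :* (C :- con (+ 1) :+ z₀)
              :+ con (+ 3) :* (con (+ 1) :- x₂) :+ con (+ 3) :* u :* (con (+ 1) :- x₁)
              :+ con (+ 3) :* g :* (con (+ 1) :- x₀) :+ con (+ 3) :* (con (+ 2) :- g :- u)
              :+ (A :+ con (+ 1)) :* (C :- con (+ 5)) :+ con (+ 3) :* A :+ con (+ 1)
            := (C :+ con (+ 1) :- (x₂ :+ u :* x₁ :+ g :* x₀ :- a :* z₁ :- b :* z₀)) :* con (+ 3))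
            refl (fromℕ (5 ℕ.+ m)) (fromℤ i₀) (fromℤ i₁) x₀ x₁ x₂ g u a b)
          (*-congʳ (+-congˡ (-‿cong (sym e₄)))))
        (pos+pos (pos+pos (pos+nonNeg (pos+pos (pos+pos (pos+pos (pos+pos (pos+nonNeg (pos+nonNeg a+b<2/3
          (nonNeg*nonNeg (inj₁ (*-pos (κ-pos 2) a-pos)) (proj₂ (near-1⇒ i₁ near₁))))
          (nonNeg*nonNeg (inj₁ (*-pos (κ-pos 2) b-pos)) (proj₂ (near-1⇒ i₀ near₀))))
          (*-pos (κ-pos 2) x₂<1)) (*-pos (*-pos (κ-pos 2) u-pos) x₁<1))
          (*-pos (*-pos (κ-pos 2) g-pos) x₀<1)) (*-pos (κ-pos 2) g+u<2))
          (nonNeg*nonNeg (inj₁ (pos+pos a+b<2/3 0<1)) 5≤C))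
          (*-pos (κ-pos 2) a+b<2/3)) 0<1)))
      (pos-cancelʳ (κ-pos 2) (pos-resp
        (trans (solve 10 (λ C z₀ z₁ x₀ x₁ x₂ g u a b →
            let A = con (+ 2) :- con (+ 3) :* (a :+ b) in
            con (+ 6) :* A :+ con (+ 3) :* a :* (C :+ con (+ 1) :- z₁) :+ con (+ 3) :* b :* (C :+ con (+ 1) :- z₀)
              :+ con (+ 3) :* x₂ :+ con (+ 3) :* u :* x₁ :+ con (+ 3) :* g :* x₀
              :+ (A :+ con (+ 1)) :* (C :- con (+ 5))
            := (C :- con (+ 1) :+ (x₂ :+ u :* x₁ :+ g :* x₀ :- a :* z₁ :- b :* z₀)) :* con (+ 3))
            refl (fromℕ (5 ℕ.+ m)) (fromℤ i₀) (fromℤ i₁) x₀ x₁ x₂ g u a b)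
          (*-congʳ (+-congˡ (sym e₄))))
        (pos+nonNeg (pos+nonNeg (pos+nonNeg (pos+nonNeg (pos+nonNeg (pos+nonNeg (*-pos (κ-pos 5) a+b<2/3)
          (nonNeg*nonNeg (inj₁ (*-pos (κ-pos 2) a-pos)) (proj₁ (near-1⇒ i₁ near₁))))
          (nonNeg*nonNeg (inj₁ (*-pos (κ-pos 2) b-pos)) (proj₁ (near-1⇒ i₀ near₀))))
          (nonNeg*nonNeg (inj₁ (κ-pos 2)) 0≤x₂)) (nonNeg*nonNeg (inj₁ (*-pos (κ-pos 2) u-pos)) 0≤x₁))
          (nonNeg*nonNeg (inj₁ (*-pos (κ-pos 2) g-pos)) 0≤x₀))
          (nonNeg*nonNeg (inj₁ (pos+pos a+b<2/3 0<1)) 5≤C))))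
    where
    e₄ = fourth-carry i₀ i₁ i₂ i₃ i₄ e₀ e₁ e₂

    5≤C : NonNeg (fromℕ (5 ℕ.+ m) + - κ 5)
    5≤C = fromℕ-mono-≤ {5} (ℕₚ.m≤m+n 5 m)

  -- For fixed carries the value is affine in (u , w). The weights are, up to the doubling at two
  -- vertices, the barycentric coordinates in the triangle; they are positive by `w<3/4`, `u-w<1/2`
  -- and `u>1`.
  barycentric : ∀ {x} i j k → x ≈ value i j k →
    fromℕ 2 * x ≈ fromℤ (corner₁ i j k) * (κ 3 + - (κ 4 * w))
                + fromℤ (corner₂ i j k) * (κ 2 * w + - (κ 2 * u) + 1#)
                + fromℤ (corner₃ i j k) * (κ 2 * (u + - 1#))
  barycentric {x} i j k e = trans (*-congˡ e) (trans
    (solve 5 (λ u w i j k →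
      let p₁ = con (+ 2) :* k :+ i :- con (+ 2) :* j
          p₂ = con (+ 2) :* p₁ :+ i in
      con (+ 2) :* (w :* i :- u :* j :+ k)
      := p₁ :* (con (+ 3) :- con (+ 4) :* w)
         :+ p₂ :* (con (+ 2) :* w :- con (+ 2) :* u :+ con (+ 1))
         :+ (p₂ :- j) :* (con (+ 2) :* (u :- con (+ 1))))
      refl u w (fromℤ i) (fromℤ j) (fromℤ k))
    (sym (+-cong (+-cong (*-congʳ c₁) (*-congʳ c₂)) (*-congʳ c₃))))
    where
    c₁ : fromℤ (corner₁ i j k) ≈ κ 2 * fromℤ k + fromℤ i + - (κ 2 * fromℤ j)
    c₁ = trans (fromℤ-- (+ 2 ℤ.* k ℤ.+ i) (+ 2 ℤ.* j)) (+-cong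
      (trans (fromℤ-+ (+ 2 ℤ.* k) i) (+-congʳ (fromℤ-* (+ 2) k))) (-‿cong (fromℤ-* (+ 2) j)))

    c₂ : fromℤ (corner₂ i j k) ≈ κ 2 * (κ 2 * fromℤ k + fromℤ i + - (κ 2 * fromℤ j)) + fromℤ i
    c₂ = trans (fromℤ-+ (+ 2 ℤ.* corner₁ i j k) i)
      (+-congʳ (trans (fromℤ-* (+ 2) (corner₁ i j k)) (*-congˡ c₁)))

    c₃ : fromℤ (corner₃ i j k) ≈ κ 2 * (κ 2 * fromℤ k + fromℤ i + - (κ 2 * fromℤ j)) + fromℤ i + - fromℤ j
    c₃ = trans (fromℤ-- (corner₂ i j k) j) (+-congʳ c₂)

  -- As all weights are positive, one strict corner inequality makes x negative. The corner values
  -- 2, 4, 4 are those of x = 1.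
  not-excluded : ∀ {x} i j k → x ≈ value i j k → NonNeg x → Pos (1# + - x) → ¬ Excluded i j k
  not-excluded {x} i j k e 0≤x x<1 (inj₁ (p₁<0 , p₂≤0 , p₃≤0)) =
    pos⇒¬nonPos
      (pos-resp (trans
          (solve 6 (λ p₁ p₂ p₃ A B D →
              (con (+ 0) :- p₁) :* A :+ (con (+ 0) :- p₂) :* B :+ (con (+ 0) :- p₃) :* D
              := :- (p₁ :* A :+ p₂ :* B :+ p₃ :* D)) refl
            (fromℤ (corner₁ i j k)) (fromℤ (corner₂ i j k)) (fromℤ (corner₃ i j k))
            (κ 3 + - (κ 4 * w)) (κ 2 * w + - (κ 2 * u) + 1#) (κ 2 * (u + - 1#)))
          (-‿cong (sym (barycentric i j k e))))
        (pos+nonNeg (pos+nonNeg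
          (*-pos (<⇒pos (fromℤ-mono-< p₁<0)) w<3/4)
          (nonNeg*nonNeg (≤⇒nonNeg (fromℤ-mono-≤ p₂≤0)) (inj₁ u-w<1/2)))
          (nonNeg*nonNeg (≤⇒nonNeg (fromℤ-mono-≤ p₃≤0)) (inj₁ (*-pos (κ-pos 1) u>1)))))
      (nonNeg-resp (solve 1 (λ x → con (+ 2) :* x := :- (:- (con (+ 2) :* x))) refl x)
        (nonNeg*nonNeg (inj₁ (κ-pos 1)) 0≤x))
  not-excluded {x} i j k e 0≤x x<1 (inj₂ (2≤p₁ , 4≤p₂ , 4≤p₃)) =
    pos⇒¬nonPos (*-pos (κ-pos 1) x<1)
      (nonNeg-resp (trans
          (solve 5 (λ p₁ p₂ p₃ u w → let A = con (+ 3) :- con (+ 4) :* w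
                                         B = con (+ 2) :* w :- con (+ 2) :* u :+ con (+ 1)
                                         D = con (+ 2) :* (u :- con (+ 1)) in
              (p₁ :- con (+ 2)) :* A :+ (p₂ :- con (+ 4)) :* B :+ (p₃ :- con (+ 4)) :* D
              := (p₁ :* A :+ p₂ :* B :+ p₃ :* D) :- con (+ 2)) refl
            (fromℤ (corner₁ i j k)) (fromℤ (corner₂ i j k)) (fromℤ (corner₃ i j k)) u w)
          (trans (+-congʳ (sym (barycentric i j k e)))
            (solve 1 (λ x → con (+ 2) :* x :- con (+ 2) := :- (con (+ 2) :* (con (+ 1) :- x))) refl x)))
        (nonNeg+nonNeg (nonNeg+nonNeg
          (nonNeg*nonNeg (≤⇒nonNeg (fromℤ-mono-≤ 2≤p₁)) (inj₁ w<3/4))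
          (nonNeg*nonNeg (≤⇒nonNeg (fromℤ-mono-≤ 4≤p₂)) (inj₁ u-w<1/2)))
          (nonNeg*nonNeg (≤⇒nonNeg (fromℤ-mono-≤ 4≤p₃)) (inj₁ (*-pos (κ-pos 1) u>1)))))

  -- The value w i - u + 1 is negative for i ≤ 0, as u > 1, and exceeds 1 for i ≥ 2, as 2w > u.
  predecessor-of-fixed-point : ∀ {x} i → x ≈ value i (+ 1) (+ 1) → NonNeg x → Pos (1# + - x) → i ≡ + 1
  predecessor-of-fixed-point {x} i e 0≤x x<1 = ℤₚ.≤-antisym
    (ℤₚ.≮⇒≥ λ 1<i → pos⇒¬nonPos x<1 (nonNeg-resp
      (trans (solve 3 (λ u w i → w :* (i :- con (+ 2)) :+ (con (+ 2) :* w :- con (+ 2) :* u :+ con (+ 1))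
                            :+ (u :- con (+ 1))
                := :- (con (+ 1) :- (w :* i :- u :* con (+ 1) :+ con (+ 1)))) refl u w (fromℤ i))
        (-‿cong (+-congˡ (-‿cong (sym e′)))))
      (inj₁ (nonNeg+pos (nonNeg+nonNeg
        (nonNeg*nonNeg (inj₁ w-pos) (≤⇒nonNeg (fromℤ-mono-≤ (ℤₚ.i<j⇒suc[i]≤j 1<i)))) (inj₁ u-w<1/2)) u>1))))
    (ℤₚ.≮⇒≥ λ i<1 → pos⇒¬nonPos
      (pos-resp
        (trans (solve 3 (λ u w i → w :* (con (+ 0) :- i) :+ (u :- con (+ 1))
                  := :- (w :* i :- u :* con (+ 1) :+ con (+ 1))) refl u w (fromℤ i))
          (-‿cong (sym e′)))
        (nonNeg+pos (nonNeg*nonNeg (inj₁ w-pos) (≤⇒nonNeg (fromℤ-mono-≤ (ℤₚ.i<j⇒i≤pred[j] i<1)))) u>1))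
      (nonNeg-resp (solve 1 (λ x → x := :- (:- x)) refl x) 0≤x))
    where
    e′ : x ≈ w * fromℤ i + - (u * 1#) + 1#
    e′ = trans e (+-cong (+-congˡ (-‿cong (*-congˡ (sym (constant≈fromℤ (+ 1)))))) (sym (constant≈fromℤ (+ 1))))

  -- Carries without driving term: contraction, search, vanishing.

  module Orbit (z : ℕ → ℤ) (x : ℕ → Carrier)
    (0≤x : ∀ k → NonNeg (x k)) (x<1 : ∀ k → Pos (1# + - x k))
    (x≈ : ∀ k → x k ≈ value (z k) (z (1 ℕ.+ k)) (z (2 ℕ.+ k))) where

    Near : ℕ → ℕ → Set
    Near m k = ℤ.∣ z k ℤ.- + 1 ∣ ℕ.≤ 4 ℕ.+ m

    near-shrinks : ∀ m k → Near (suc m) k → Near (suc m) (1 ℕ.+ k) → Near m (4 ℕ.+ k)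
    near-shrinks m k = fourth-carry-near-1 m (z k) (z (1 ℕ.+ k)) (z (2 ℕ.+ k)) (z (3 ℕ.+ k)) (z (4 ℕ.+ k))
      (x≈ k) (x≈ (1 ℕ.+ k)) (x≈ (2 ℕ.+ k)) (0≤x k) (0≤x (1 ℕ.+ k)) (0≤x (2 ℕ.+ k))
      (x<1 k) (x<1 (1 ℕ.+ k)) (x<1 (2 ℕ.+ k))

    near-suc : ∀ {m k} → Near m k → Near (suc m) k
    near-suc near = ℕₚ.≤-trans near (ℕₚ.n≤1+n _)

    -- The radius 5 + m is large enough for `near-shrinks`, which carries the bound from k and k + 1
    -- to k + 4; only the first four carries need an explicit bound.
    bounded : Σ ℕ λ m → ∀ k → Near (suc m) k
    bounded = m , near
      where
      dist : ℕ → ℕ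
      dist k = ℤ.∣ z k ℤ.- + 1 ∣

      m : ℕ
      m = dist 0 ℕ.+ dist 1 ℕ.+ dist 2 ℕ.+ dist 3

      near : ∀ k → Near (suc m) k
      near 0 = ℕₚ.m≤n⇒m≤o+n 5 (ℕₚ.m≤n⇒m≤n+o (dist 3) (ℕₚ.m≤n⇒m≤n+o (dist 2) (ℕₚ.m≤m+n (dist 0) (dist 1))))
      near 1 = ℕₚ.m≤n⇒m≤o+n 5 (ℕₚ.m≤n⇒m≤n+o (dist 3) (ℕₚ.m≤n⇒m≤n+o (dist 2) (ℕₚ.m≤n+m (dist 1) (dist 0))))
      near 2 = ℕₚ.m≤n⇒m≤o+n 5 (ℕₚ.m≤n⇒m≤n+o (dist 3) (ℕₚ.m≤n+m (dist 2) (dist 0 ℕ.+ dist 1)))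
      near 3 = ℕₚ.m≤n⇒m≤o+n 5 (ℕₚ.m≤n+m (dist 3) (dist 0 ℕ.+ dist 1 ℕ.+ dist 2))
      near (suc (suc (suc (suc k)))) = near-suc {m} {4 ℕ.+ k} (near-shrinks m k (near k) (near (suc k)))

    -- Each delay by four indices lowers the radius by one, until it is 4.
    descend : ∀ m K → (∀ k → K ℕ.≤ k → Near m k) → Σ ℕ λ K′ → ∀ k → K′ ℕ.≤ k → Near 0 k
    descend zero    K near = K , near
    descend (suc m) K near = descend m (4 ℕ.+ K) λ where
      (suc (suc (suc (suc k)))) (ℕ.s≤s (ℕ.s≤s (ℕ.s≤s (ℕ.s≤s K≤k)))) →
        near-shrinks m k (near k K≤k) (near (suc k) (ℕₚ.m≤n⇒m≤1+n K≤k))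

    Settled : ℕ → Set
    Settled k = (z k ≡ + 0 × z (suc k) ≡ + 0) ⊎ (z k ≡ + 1 × z (suc k) ≡ + 1)

    -- Follows the actual carries down the search tree; the orbit lies in [0,1), which rules out the
    -- excluded branches.
    settles : ∀ n k → (∀ l → k ℕ.≤ l → Near 0 l) → Settles n (z k) (z (suc k)) → Σ ℕ Settled
    settles (suc n) k near (inj₁ zeros) = k , inj₁ zeros
    settles (suc n) k near (inj₂ (inj₁ ones)) = k , inj₂ ones
    settles (suc n) k near (inj₂ (inj₂ next))
      with All.lookup next (∈-window (z (2 ℕ.+ k)) (near (2 ℕ.+ k) (ℕₚ.m≤n+m k 2)))
    ... | inj₁ excluded = ⊥-elim (not-excluded (z k) (z (1 ℕ.+ k)) (z (2 ℕ.+ k)) (x≈ k) (0≤x k) (x<1 k) excluded)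
    ... | inj₂ rest = settles n (suc k) (λ l k<l → near l (ℕₚ.<⇒≤ k<l)) rest

    settled : Σ ℕ Settled
    settled with bounded
    ... | m , near with descend (suc m) 0 (λ k _ → near k)
    ...   | K , near₀ = settles depth K near₀ (All.lookup (All.lookup all-settle
              (∈-window (z K) (near₀ K ℕₚ.≤-refl))) (∈-window (z (suc K)) (near₀ (suc K) (ℕₚ.n≤1+n K))))

    ones-from-start : ∀ k → z k ≡ + 1 → z (suc k) ≡ + 1 → z 0 ≡ + 1
    ones-from-start zero    z₀≡1 _ = z₀≡1
    ones-from-start (suc k) z₁≡1 z₂≡1 = ones-from-start k (predecessor-of-fixed-point (z k)
      (≡.subst₂ (λ i j → x k ≈ value (z k) i j) z₁≡1 z₂≡1 (x≈ k)) (0≤x k) (x<1 k)) z₁≡1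

    vanishes : z 0 ℤ.≤ + 0 → Σ ℕ λ k → x k ≈ 0#
    vanishes z₀≤0 with settled
    ... | k , inj₂ (z≡1 , z′≡1) = ⊥-elim (ℤₚ.<⇒≱ (ℤ.+<+ (ℕ.s≤s ℕ.z≤n))
      (≡.subst (ℤ._≤ + 0) (ones-from-start k z≡1 z′≡1) z₀≤0))
    ... | k , inj₁ (z≡0 , z′≡0) = k , trans x≈z₂ (reflexive (≡.cong fromℤ z₂≡0))
      where
      x≈z₂ : x k ≈ fromℤ (z (2 ℕ.+ k))
      x≈z₂ = trans (≡.subst₂ (λ i j → x k ≈ value i j (z (2 ℕ.+ k))) z≡0 z′≡0 (x≈ k))
        (solve 3 (λ u w k → w :* con (+ 0) :- u :* con (+ 0) :+ k := k) refl u w (fromℤ (z (2 ℕ.+ k))))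

      z₂≡0 : z (2 ℕ.+ k) ≡ + 0
      z₂≡0 = between-0-and-1 (nonNeg-resp x≈z₂ (0≤x k)) (pos-resp (+-congˡ (-‿cong x≈z₂)) (x<1 k))

  -- Carries with driving term: sign and size.

  β²>w+uβ : Pos (β * β + - w + - (u * β))
  -- By `w≈`, w + uβ equals β + u, so the claim is β² > β + u.
  β²>w+uβ = pos-cancelʳ (κ-pos 3) (pos-resp (sym (≈-mod (- κ 4) w≈ (solve 3 (λ u w β →
      (β :* β :- w :- u :* β) :* con (+ 4) :+ (:- con (+ 4)) :* (β :+ u :- u :* β)
      := con (+ 4) :* β :* (β :- con (+ 2)) :+ (con (+ 4) :* β :- con (+ 11)) :+ (con (+ 5) :- con (+ 4) :* u) :+ con (+ 6)
         :+ (:- con (+ 4)) :* w) refl u w β)))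
    (pos+pos (pos+pos (pos+pos (*-pos (*-pos (κ-pos 3) β-pos) β>2) β>11/4) u<5/4) (κ-pos 5)))

  module DrivenOrbit (z : ℕ → ℤ) (x μ : ℕ → Carrier)
    (0≤x : ∀ k → NonNeg (x k)) (x<1 : ∀ k → Pos (1# + - x k))
    (0≤μ : ∀ k → NonNeg (μ k)) (μ-suc : ∀ k → μ (suc k) ≈ β * μ k)
    (x≈ : ∀ k → x k ≈ μ k + value (z k) (z (1 ℕ.+ k)) (z (2 ℕ.+ k)))
    (z₀≡0 : z 0 ≡ + 0) (z₁≡0 : z 1 ≡ + 0) where

    Dominated : ℕ → Set _
    Dominated k = z k ℤ.≤ + 0 × NonNeg (μ k + w * fromℤ (z k))

    private
      start : ∀ k → z k ≡ + 0 → Dominated k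
      start k z≡0 = ℤₚ.≤-reflexive z≡0 , nonNeg-resp
        (sym (trans (+-congˡ (trans (*-congˡ (reflexive (≡.cong fromℤ z≡0))) (zeroʳ w))) (+-identityʳ (μ k))))
        (0≤μ k)

      -- Here z₂ = x - (μ₀ + w z₀) + u z₁ < 1, so the integer z₂ is at most 0. Moreover μ₂ + w z₂ =
      -- (β² - w - uβ) μ₀ + w x + u (μ₁ + w z₁) - w² z₀, a sum of nonnegative terms.
      step : ∀ k → Dominated k → Dominated (1 ℕ.+ k) → Dominated (2 ℕ.+ k)
      step k (z₀≤0 , μ₀≥) (z₁≤0 , μ₁≥) = z₂≤0 , nonNeg-resp
          (sym (≈-mod 1# (μ-suc (suc k)) (≈-mod (β + - u) (μ-suc k) (≈-mod (- w) (x≈ k)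
            (solve 10 (λ u w β x m₀ m₁ m₂ z₀ z₁ z₂ →
              m₂ :+ w :* z₂ :+ con (+ 1) :* (β :* m₁) :+ (β :- u) :* (β :* m₀)
                 :+ (:- w) :* (m₀ :+ (w :* z₀ :- u :* z₁ :+ z₂))
              := (β :* β :- w :- u :* β) :* m₀ :+ w :* x :+ u :* (m₁ :+ w :* z₁) :+ w :* w :* (con (+ 0) :- z₀)
                 :+ con (+ 1) :* m₂ :+ (β :- u) :* m₁ :+ (:- w) :* x)
              refl u w β (x k) (μ k) (μ (1 ℕ.+ k)) (μ (2 ℕ.+ k))
              (fromℤ (z k)) (fromℤ (z (1 ℕ.+ k))) (fromℤ (z (2 ℕ.+ k))))))))
          (nonNeg+nonNeg (nonNeg+nonNeg (nonNeg+nonNeg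
            (nonNeg*nonNeg (inj₁ β²>w+uβ) (0≤μ k))
            (nonNeg*nonNeg (inj₁ w-pos) (0≤x k)))
            (nonNeg*nonNeg (inj₁ u-pos) μ₁≥))
            (nonNeg*nonNeg (inj₁ (*-pos w-pos w-pos)) (≤⇒nonNeg (fromℤ-mono-≤ z₀≤0))))
        where
        z₂≤0 : z (2 ℕ.+ k) ℤ.≤ + 0
        z₂≤0 = fromℤ-cancel-≤ (pos⇒< (pos-resp
          (sym (≈-mod (- 1#) (sym (x≈ k)) (solve 7 (λ u w x m z₀ z₁ z₂ →
              (con (+ 0) :+ con (+ 1)) :- z₂ :+ (:- con (+ 1)) :* x
              := (con (+ 1) :- x) :+ (m :+ w :* z₀) :+ u :* (con (+ 0) :- z₁)
                 :+ (:- con (+ 1)) :* (m :+ (w :* z₀ :- u :* z₁ :+ z₂)))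
              refl u w (x k) (μ k) (fromℤ (z k)) (fromℤ (z (1 ℕ.+ k))) (fromℤ (z (2 ℕ.+ k))))))
          (pos+nonNeg (pos+nonNeg (x<1 k) μ₀≥)
            (nonNeg*nonNeg (inj₁ u-pos) (≤⇒nonNeg (fromℤ-mono-≤ z₁≤0))))))

    dominated : ∀ k → Dominated k × Dominated (suc k)
    dominated zero    = start 0 z₀≡0 , start 1 z₁≡0
    dominated (suc k) with dominated k
    ... | dom₀ , dom₁ = dom₁ , step k dom₀ dom₁

  -- Powers of 1/β and the scaling exponent.

  s-pos : Pos s
  s-pos = pos-cancelʳ β-pos (pos-resp (trans (sym βs≈1) (*-comm β s)) 0<1)

  s<1/2 : Pos (1# + - (κ 2 * s))
  s<1/2 = pos-cancelʳ β-pos (pos-resp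
    (sym (≈-mod (- κ 2) βs≈1 (solve 2 (λ β s →
      (con (+ 1) :- con (+ 2) :* s) :* β :+ (:- con (+ 2)) :* con (+ 1)
      := (β :- con (+ 2)) :+ (:- con (+ 2)) :* (β :* s)) refl β s))) β>2)

  s^-pos : ∀ n → Pos (s ^ᴿ n)
  s^-pos zero    = 0<1
  s^-pos (suc n) = *-pos s-pos (s^-pos n)

  -- Induction with s < 1/2 and n + 2 ≤ 2(n + 1). It makes n an explicit exponent with n sⁿ < 1.
  [1+n]sⁿ≤1 : ∀ n → NonNeg (1# + - ((1# + fromℕ n) * s ^ᴿ n))
  [1+n]sⁿ≤1 zero = inj₂ (solve 0 (con (+ 0) := con (+ 1) :- (con (+ 1) :+ con (+ 0)) :* con (+ 1)) refl)
  [1+n]sⁿ≤1 (suc n) = nonNeg-resp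
    (solve 3 (λ s p n → (con (+ 1) :- con (+ 2) :* s) :+ con (+ 2) :* s :* (con (+ 1) :- (con (+ 1) :+ n) :* p)
        :+ n :* (s :* p)
      := con (+ 1) :- (con (+ 1) :+ (con (+ 1) :+ n)) :* (s :* p)) refl s (s ^ᴿ n) (fromℕ n))
    (nonNeg+nonNeg (nonNeg+nonNeg (inj₁ s<1/2) (nonNeg*nonNeg (inj₁ (*-pos (κ-pos 1) s-pos)) ([1+n]sⁿ≤1 n)))
      (nonNeg*nonNeg (fromℕ-nonNeg n) (inj₁ (s^-pos (suc n)))))

  nsⁿ<1 : ∀ n → (fromℕ n * s ^ᴿ n) < 1#
  nsⁿ<1 n = pos⇒< (pos-resp
    (solve 2 (λ p n → (con (+ 1) :- (con (+ 1) :+ n) :* p) :+ p := con (+ 1) :- n :* p) refl (s ^ᴿ n) (fromℕ n))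
    (nonNeg+pos ([1+n]sⁿ≤1 n) (s^-pos n)))

  sⁿβⁿ≈1 : ∀ n → s ^ᴿ n * β ^ᴿ n ≈ 1#
  sⁿβⁿ≈1 zero    = *-identityˡ 1#
  sⁿβⁿ≈1 (suc n) = trans
    (solve 4 (λ s p β q → s :* p :* (β :* q) := β :* s :* (p :* q)) refl s (s ^ᴿ n) β (β ^ᴿ n))
    (trans (*-cong βs≈1 (sⁿβⁿ≈1 n)) (*-identityˡ 1#))

  -- The carry recursion along an expansion.

  Carry : Set
  Carry = ℤ × ℤ × ℤ

  -- From βw = t, βu = 2t - w and β = 2t - u: the new last entry is what remains of β(w i - u j + k)
  -- - d after subtracting w j - u k. Because of the shift, later entries of a triple are by
  -- definition first entries of later triples.
  next-carry : Carry → ℤ → Carry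
  next-carry (i , j , k) d = j , k , + t ℤ.* (i ℤ.- + 2 ℤ.* j ℤ.+ + 2 ℤ.* k) ℤ.- d

  carries : Carry → Carrier → ℕ → Carry
  carries init y zero    = init
  carries init y (suc k) = next-carry (carries init y k) (digit β k y)

  carryValue : Carry → Carrier
  carryValue (i , j , k) = value i j k

  next-carryValue : ∀ x m cs d → x ≈ m + carryValue cs →
    β * x + - fromℤ d ≈ β * m + carryValue (next-carry cs d)
  next-carryValue x m (i , j , k) d x≈ = trans
    (+-congʳ (*-congˡ x≈))
    (trans
      (≈-mod (fromℤ i) wβ (≈-mod (- fromℤ j) uβ (solve 9 (λ β τ w u m i j k d →
        β :* (m :+ (w :* i :- u :* j :+ k)) :- d :+ i :* τ :+ (:- j) :* (con (+ 2) :* τ :- w)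
        := β :* m :+ (w :* j :- (con (+ 2) :* τ :- β) :* k
             :+ (τ :* (i :- con (+ 2) :* j :+ con (+ 2) :* k) :- d)) :+ i :* (w :* β) :+ (:- j) :* (u :* β)) refl β τ w u m (fromℤ i) (fromℤ j) (fromℤ k) (fromℤ d))))
      (+-congˡ (+-congˡ (sym third))))
    where
    third : fromℤ (+ t ℤ.* (i ℤ.- + 2 ℤ.* j ℤ.+ + 2 ℤ.* k) ℤ.- d)
          ≈ τ * (fromℤ i + - (κ 2 * fromℤ j) + κ 2 * fromℤ k) + - fromℤ d
    third = trans (fromℤ-- (+ t ℤ.* (i ℤ.- + 2 ℤ.* j ℤ.+ + 2 ℤ.* k)) d) (+-congʳ
      (trans (fromℤ-* (+ t) (i ℤ.- + 2 ℤ.* j ℤ.+ + 2 ℤ.* k)) (*-congˡ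
        (trans (fromℤ-+ (i ℤ.- + 2 ℤ.* j) (+ 2 ℤ.* k)) (+-cong
          (trans (fromℤ-- i (+ 2 ℤ.* j)) (+-congˡ (-‿cong (fromℤ-* (+ 2) j))))
          (fromℤ-* (+ 2) k))))))

  -- Used twice: with m the scaled number and zero carries, and, from time L on, with m = 0 and the
  -- carries reached by then.
  Tⁿ≈carries : ∀ {y} init m → y ≈ m + carryValue init →
    ∀ k → Tⁿ β k y ≈ m * β ^ᴿ k + carryValue (carries init y k)
  Tⁿ≈carries init m y≈ zero = trans y≈ (+-congʳ (sym (*-identityʳ m)))
  Tⁿ≈carries {y} init m y≈ (suc k) = trans
    (next-carryValue (Tⁿ β k y) (m * β ^ᴿ k) (carries init y k) (digit β k y) (Tⁿ≈carries init m y≈ k))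
    (+-congʳ (solve 3 (λ β m p → β :* (m :* p) := m :* (β :* p)) refl β m (β ^ᴿ k)))

  orbit-vanishes : ∀ {y} i j k → y ≈ value i j k → NonNeg y → Pos (1# + - y) → i ℤ.≤ + 0 →
                   Σ ℕ λ n → Tⁿ β n y ≈ 0#
  orbit-vanishes {y} i j k y≈ 0≤y y<1 i≤0 =
    Orbit.vanishes (λ n → proj₁ (carries (i , j , k) y n)) (λ n → Tⁿ β n y) (Tⁿ-nonNeg 0≤y) (Tⁿ<1 y<1)
      (λ n → trans (Tⁿ≈carries (i , j , k) 0# (trans y≈ (sym (+-identityˡ _))) n)
        (trans (+-congʳ (zeroˡ _)) (+-identityˡ _))) i≤0

  -- Finiteness of the expansions of natural numbers.

  module _ (n L : ℕ) (small : (fromℕ n * s ^ᴿ L) < 1#) where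
    private
      y : Carrier
      y = fromℕ n * s ^ᴿ L

      0≤y : NonNeg y
      0≤y = nonNeg*nonNeg (fromℕ-nonNeg n) (inj₁ (s^-pos L))

      z : ℕ → ℤ
      z k = proj₁ (carries (+ 0 , + 0 , + 0) y k)

      Tⁿy≈ : ∀ k → Tⁿ β k y ≈ y * β ^ᴿ k + value (z k) (z (1 ℕ.+ k)) (z (2 ℕ.+ k))
      Tⁿy≈ = Tⁿ≈carries (+ 0 , + 0 , + 0) y (solve 3 (λ u w y →
        y := y :+ (w :* con (+ 0) :- u :* con (+ 0) :+ con (+ 0))) refl u w y)

      z≤0 : z L ℤ.≤ + 0
      z≤0 = proj₁ (proj₁ (DrivenOrbit.dominated z (λ k → Tⁿ β k y) (λ k → y * β ^ᴿ k)
        (Tⁿ-nonNeg 0≤y) (Tⁿ<1 (<⇒pos small))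
        (λ k → nonNeg*nonNeg 0≤y (inj₁ (β^-pos k)))
        (λ k → solve 3 (λ β y p → y :* (β :* p) := β :* (y :* p)) refl β y (β ^ᴿ k))
        Tⁿy≈ ≡.refl ≡.refl L))
        where
        β^-pos : ∀ k → Pos (β ^ᴿ k)
        β^-pos zero    = 0<1
        β^-pos (suc k) = *-pos β-pos (β^-pos k)

      -- At time L the driving term is the integer n. It is added to the newest carry, so the first
      -- carry keeps its sign.
      Tᴸy≈ : Tⁿ β L y ≈ value (z L) (z (1 ℕ.+ L)) (z (2 ℕ.+ L) ℤ.+ + n)
      Tᴸy≈ = trans (Tⁿy≈ L) (trans
        (≈-mod (fromℕ n) (sⁿβⁿ≈1 L) (solve 7 (λ n p q v i j k →
          n :* p :* q :+ (v :* i :+ j :+ k) :+ n :* con (+ 1)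
          := v :* i :+ j :+ (k :+ n) :+ n :* (p :* q)) refl
          (fromℕ n) (s ^ᴿ L) (β ^ᴿ L) w (fromℤ (z L)) (- (u * fromℤ (z (1 ℕ.+ L)))) (fromℤ (z (2 ℕ.+ L)))))
        (+-congˡ (sym (fromℤ-+ (z (2 ℕ.+ L)) (+ n)))))

    finite-digits : FiniteDigits β y
    finite-digits = vanishing⇒finite (proj₁ vanishes ℕ.+ L)
      (trans (reflexive (Tⁿ-+ (proj₁ vanishes) L y)) (proj₂ vanishes))
      where
      vanishes : Σ ℕ λ k → Tⁿ β k (Tⁿ β L y) ≈ 0#
      vanishes = orbit-vanishes (z L) (z (1 ℕ.+ L)) (z (2 ℕ.+ L) ℤ.+ + n) Tᴸy≈
        (Tⁿ-nonNeg 0≤y L) (Tⁿ<1 (<⇒pos small) L) z≤0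

  propF1 : PropF1 β
  propF1 n =
    -- By `nsⁿ<1`, the number n itself bounds the search for the scaling exponent.
    let L , small , minimal = least (λ k → (fromℕ n * s ^ᴿ k) <? 1#) n (nsⁿ<1 n)
    in fromℕ-nonNeg n , L , (small , minimal) , finite-digits n L small

  -- Failure of (PF).

  -- Equals (t − 1) / (β − 1).
  φ : Carrier
  φ = 1# + - w + w * s

  ws≈2w-u : w * s ≈ κ 2 * w + - u
  ws≈2w-u = ≈-mod (- s) ws≈ (≈-mod (κ 2 * w + - u) βs≈1 (solve 4 (λ β u w s →
    w :* s :+ (:- s) :* w :+ (con (+ 2) :* w :- u) :* con (+ 1)
    := con (+ 2) :* w :- u :+ (:- s) :* ((con (+ 2) :* w :- u) :* β) :+ (con (+ 2) :* w :- u) :* (β :* s))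
    refl β u w s))

  -- Both sides equal β - t + w. Hence φ is a fixed point of the transformation with digit t - 1.
  βφ≈ : β * φ ≈ fromℤ (+ t ℤ.- + 1) + φ
  βφ≈ = trans
    (≈-mod (- 1#) wβ (≈-mod w βs≈1 (≈-mod (- 1#) ws≈2w-u (solve 4 (λ τ β w s →
      β :* (con (+ 1) :- w :+ w :* s) :+ (:- con (+ 1)) :* τ :+ w :* con (+ 1)
        :+ (:- con (+ 1)) :* (con (+ 2) :* w :- (con (+ 2) :* τ :- β))
      := (τ :- con (+ 1)) :+ (con (+ 1) :- w :+ w :* s) :+ (:- con (+ 1)) :* (w :* β) :+ w :* (β :* s)
        :+ (:- con (+ 1)) :* (w :* s)) refl τ β w s))))
    (+-congʳ (sym (trans (fromℤ-- (+ t) (+ 1)) (+-congˡ (-‿cong (sym (constant≈fromℤ (+ 1))))))))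

  φ-pos : Pos φ
  φ-pos = pos-cancelʳ (κ-pos 3) (pos-resp (solve 2 (λ w s →
      (con (+ 3) :- con (+ 4) :* w) :+ con (+ 1) :+ con (+ 4) :* (w :* s)
      := (con (+ 1) :- w :+ w :* s) :* con (+ 4)) refl w s)
    (pos+pos (pos+pos w<3/4 0<1) (*-pos (κ-pos 3) (*-pos w-pos s-pos))))

  φ<1 : Pos (1# + - φ)
  φ<1 = pos-resp (solve 2 (λ w s → w :* ((con (+ 1) :- con (+ 2) :* s) :+ s)
      := con (+ 1) :- (con (+ 1) :- w :+ w :* s)) refl w s)
    (*-pos w-pos (pos+pos s<1/2 s-pos))

  -- Substitute 1 = (2t−2)/β + (2t−2)/β² + (t−1)/β³ + t/β⁶ into φ = 1 − t/β + t/β².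
  φ-digits : List ℕ
  φ-digits = 0 ∷ t ℕ.∸ 2 ∷ 3 ℕ.* t ℕ.∸ 2 ∷ t ℕ.∸ 1 ∷ 0 ∷ 0 ∷ t ∷ []

  evalInv-φ-digits : evalInv β φ-digits ≈ φ
  evalInv-φ-digits = trans
    (+-congˡ (*-congˡ (+-cong t-2 (*-congˡ (+-cong 3t-2 (*-congˡ (+-congʳ t-1)))))))
    (≈-mod (h * s) ws≈2w-u (≈-mod h βs≈1 (solve 3 (λ τ β s →
      let w = τ :* s; u = con (+ 2) :* τ :- β
          h = (con (+ 1) :+ con (+ 2) :* s :+ con (+ 2) :* (s :* s) :+ s :* s :* s) in
      con (+ 0) :+ s :* ((τ :- con (+ 2)) :+ s :* ((con (+ 3) :* τ :- con (+ 2)) :+ s :* ((τ :- con (+ 1))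
        :+ s :* (con (+ 0) :+ s :* (con (+ 0) :+ s :* (τ :+ s :* con (+ 0)))))))
        :+ h :* s :* (con (+ 2) :* w :- u) :+ h :* con (+ 1)
      := (con (+ 1) :- w :+ w :* s) :+ h :* s :* (w :* s) :+ h :* (β :* s)) refl τ β s)))
    where
    -- The cofactor: `h` times the cubic divided by β³ is the relation that is substituted into φ.
    h : Carrier
    h = 1# + κ 2 * s + κ 2 * (s * s) + s * s * s

    fromℕ-∸ : ∀ {m n} → n ≤ m → fromℕ (m ℕ.∸ n) ≈ fromℕ m + - fromℕ n
    fromℕ-∸ {m} {n} n≤m = trans
      (solve 2 (λ d n → d := d :+ n :- n) refl (fromℕ (m ℕ.∸ n)) (fromℕ n))
      (+-congʳ (trans (sym (fromℕ-+ (m ℕ.∸ n) n)) (reflexive (≡.cong fromℕ (ℕₚ.m∸n+n≡m n≤m)))))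

    t-1 : fromℕ (t ℕ.∸ 1) ≈ τ + - 1#
    t-1 = trans (fromℕ-∸ (ℕₚ.≤-trans (ℕ.s≤s ℕ.z≤n) 2≤t)) (+-congˡ (-‿cong (sym (constant≈fromℤ (+ 1)))))

    t-2 : fromℕ (t ℕ.∸ 2) ≈ τ + - κ 2
    t-2 = fromℕ-∸ 2≤t

    3t-2 : fromℕ (3 ℕ.* t ℕ.∸ 2) ≈ κ 3 * τ + - κ 2
    3t-2 = trans (fromℕ-∸ (ℕₚ.≤-trans 2≤t (ℕₚ.m≤n*m t 3))) (+-congʳ (fromℕ-* 3 t))

  ¬propPF : ¬ PropPF β
  ¬propPF pf with pf φ-digits
  -- As φ < 1, its scaling exponent is 0; a positive one contradicts minimality.
  ... | _ , suc L , (_ , minimal) , _ = minimal 0 (ℕ.s≤s ℕ.z≤n)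
        (<-resp (sym (trans (*-identityʳ _) evalInv-φ-digits)) refl (pos⇒< φ<1))
  -- Every digit of φ is t - 1 ≥ 1, in particular the one at the alleged bound `N`.
  ... | _ , zero , _ , N , zeros = ℤₚ.<⇒≢ (ℤₚ.<-≤-trans (ℤ.+<+ (ℕ.s≤s ℕ.z≤n)) (ℤₚ.+-monoˡ-≤ (ℤ.- + 1) (ℤ.+≤+ 2≤t)))
        (≡.sym (≡.trans (≡.sym (FixedPoint.digit-fixed (+ t ℤ.- + 1) βφ≈ (inj₁ φ-pos) φ<1
          (trans (*-identityʳ _) evalInv-φ-digits) N)) (zeros N ℕₚ.≤-refl)))

theorem1p2 : ∀ {c ℓ r} (F : FloorField c ℓ r) (t : ℕ) → 2 ≤ t →
    (β : Car F) → Beta.GreaterThanOne F β → Beta.IsRootOfCubic F β t →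
    Beta.PropF1 F β × ¬ Beta.PropPF F β
theorem1p2 F t 2≤t β 1<β β-root =
  CubicRoot.propF1 F t 2≤t β 1<β β-root , CubicRoot.¬propPF F t 2≤t β 1<β β-root
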